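{- Let $G$ be an embedded graph such that $G^{*\times}$ is orientable, and let $k\in\mathbb{N}$. Then $$P(G;-k)=(-1)^{f(G)}\sum_{\phi\in\mathcal{P}(G_m,k)}2^{\mathrm{tot}(\phi)}.$$
   Context: An embedded graph is a graph (loops and multiple edges allowed, not necessarily connected) cellularly embedded in a closed, possibly non-orientable, surface, i.e. each component of the complement (each face) is an open disc. Equivalently, it is a ribbon graph: a surface with boundary written as a union of vertex discs and edge discs (ribbons), each edge disc meeting the vertex discs in exactly two disjoint arcs. $f(G)$ is the number of boundary components of the ribbon graph (number of faces). An embedded graph is orientable if its surface is orientable. $G^*$ is the geometric dual of $G$. The partial Petrial $G^{\tau(A)}$, $A\subseteq E(G)$, is the ribbon graph obtained from $G$ by adding a half-twist to each edge in $A$, the Petrie dual is $G^{\times}=G^{\tau(E(G))}$, and $G^{*\times}=(G^*)^{\times}$. Penrose polynomial: $P(G;\lambda)=\sum_{A\subseteq E(G)}(-1)^{|A|}\lambda^{f(G^{\tau(A)})}$. Medial graph: $G_m$ is the 4-regular graph embedded in the same surface obtained by placing a vertex $v_e$ on each edge $e$ of $G$ and drawing the edges of $G_m$ by following the face boundaries of $G$. An isolated vertex of $G$ contributes a free loop (a circular edge with no vertex), which counts as an edge of $G_m$. The canonical checkerboard colouring of $G_m$ colours black the faces of $G_m$ containing a vertex of $G$ and colours white the remaining faces (which correspond to the faces of $G$). $k$-valuations: a $k$-valuation of $G_m$ is a map $\phi:E(G_m)\to\{1,\dots,k\}$ (free loops are coloured too) such that for every colour $i$ and every vertex $v$ the number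 of $i$-coloured half-edges at $v$ is even. At a vertex $v$ let $h_1,h_2,h_3,h_4$ be the incident half-edges in cyclic order, labelled so that the corners between $h_1,h_2$ and between $h_3,h_4$ are white and those between $h_2,h_3$ and between $h_4,h_1$ are black. The type of $\phi$ at $v$ is total if all four half-edges have the same colour; otherwise two distinct colours occur, each twice, and the type is white if $h_1,h_2$ agree and $h_3,h_4$ agree; black if $h_2,h_3$ agree and $h_4,h_1$ agree; crossing if $h_1,h_3$ agree and $h_2,h_4$ agree. $\mathrm{tot}(\phi)$ is the number of vertices of total type. $\mathcal{P}(G_m,k)$ is the set of $P$-permissible $k$-valuations, i.e. those for which every vertex is of white, crossing or total type. $\mathbb{N}$ denotes the positive integers. -}

module Defs where

open import Data.Bool using (Bool; true; false; not; _∧_; _xor_)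
open import Data.Bool.Properties using () renaming (_≟_ to _≟ᵇ_)
open import Data.Fin using (Fin)
open import Data.Fin.Patterns using (0F; 1F; 2F; 3F)
open import Data.Fin.Properties using (all?) renaming (_≟_ to _≟ᶠ_)
open import Data.Fin.Subset using (Subset; inside; outside; ⊤; ∣_∣)
open import Data.Integer using (ℤ; 0ℤ; -1ℤ) renaming (_+_ to _+ℤ_; _*_ to _*ℤ_; _^_ to _^ℤ_)
open import Data.List as List using (List; []; _∷_; length; deduplicate; cartesianProduct; cartesianProductWith; filter; foldr)
open import Data.List.Membership.Propositional using (_∈_)
open import Data.List.Membership.Propositional.Properties using (∈-allFin; ∈-cartesianProduct⁺)
open import Data.List.Relation.Unary.Any using (here; there)
open import Data.Nat using (ℕ; zero; suc; _+_)
open import Data.Nat.Divisibility using (_∣_; _∣?_)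
open import Data.Product using (Σ-syntax; _×_; _,_; proj₁)
open import Data.Product.Properties using (≡-dec)
open import Data.Sum using (_⊎_; inj₁; inj₂)
open import Data.Vec as Vec using (Vec; []; _∷_; lookup)
open import Function using (_∘_)
open import Relation.Binary using (Rel; Decidable; DecidableEquality)
open import Relation.Binary.Construct.Closure.ReflexiveTransitive using (Star; ε; _◅_; _◅◅_)
open import Relation.Binary.PropositionalEquality using (_≡_; _≢_; refl; sym; trans; cong)
open import Relation.Nullary using (¬?; _×-dec_; _⊎-dec_)
open import Level using (0ℓ)
open import Relation.Nullary.Decidable using (map′)
open import Relation.Unary using () renaming (Decidable to Decidable₁)

------------------------------------------------------------------------
-- Reachability in a finite set is decidable

module Reachability {A : Set} (_≟_ : DecidableEquality A)
                    (elements : List A) (complete : ∀ x → x ∈ elements)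
                    {_⟶_ : Rel A 0ℓ} (_⟶?_ : Decidable _⟶_) where

  -- There is a path whose intermediate points all lie in the list.
  Via : List A → Rel A 0ℓ
  Via []       x y = x ≡ y ⊎ x ⟶ y
  Via (z ∷ zs) x y = Via zs x y ⊎ (Via zs x z × Via zs z y)

  via? : ∀ zs → Decidable (Via zs)
  via? []       x y = (x ≟ y) ⊎-dec (x ⟶? y)
  via? (z ∷ zs) x y = via? zs x y ⊎-dec (via? zs x z ×-dec via? zs z y)

  sound : ∀ zs {x y} → Via zs x y → Star _⟶_ x y
  sound []       (inj₁ refl)    = ε
  sound []       (inj₂ s)       = s ◅ ε
  sound (z ∷ zs) (inj₁ p)       = sound zs p
  sound (z ∷ zs) (inj₂ (p , q)) = sound zs p ◅◅ sound zs q

  base : ∀ zs {x y} → x ≡ y ⊎ x ⟶ y → Via zs x y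
  base []       p = p
  base (z ∷ zs) p = inj₁ (base zs p)

  toHead : ∀ {z zs x} → Via (z ∷ zs) x z → Via zs x z
  toHead (inj₁ p)       = p
  toHead (inj₂ (p , _)) = p

  fromHead : ∀ {z zs y} → Via (z ∷ zs) z y → Via zs z y
  fromHead (inj₁ p)       = p
  fromHead (inj₂ (_ , p)) = p

  join : ∀ {zs x w y} → w ∈ zs → Via zs x w → Via zs w y → Via zs x y
  join (here refl) p q = inj₂ (toHead p , fromHead q)
  join (there i) (inj₁ p)       (inj₁ q)       = inj₁ (join i p q)
  join (there i) (inj₁ p)       (inj₂ (q , r)) = inj₂ (join i p q , r)
  join (there i) (inj₂ (p , q)) (inj₁ r)       = inj₂ (p , join i q r)
  join (there i) (inj₂ (p , _)) (inj₂ (_ , r)) = inj₂ (p , r)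

  reach : ∀ {x y} → Star _⟶_ x y → Via elements x y
  reach ε       = base elements (inj₁ refl)
  reach (s ◅ p) = join (complete _) (base elements (inj₂ s)) (reach p)

  star? : Decidable (Star _⟶_)
  star? x y = map′ (sound elements) reach (via? elements x y)

------------------------------------------------------------------------
-- Embedded graphs

-- Each ribbon is a rectangle with a chosen coordinate system.  The flag
-- (e , a , b) is the corner of the ribbon e at its end a (where it meets
-- a vertex disc) and on its side b (part of the boundary of the surface).
Flag : ℕ → Set
Flag n = Fin n × Bool × Bool

-- τ₀ runs along the side of a ribbon, τ₂ along the end of a ribbon.
τ₀ τ₂ : ∀ {n} → Flag n → Flag n
τ₀ (e , a , b) = e , not a , b
τ₂ (e , a , b) = e , a , not b

-- The boundary of a vertex disc alternates between ribbon ends and free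
-- arcs; τ₁ exchanges the two endpoints of each free arc.  Hence the
-- vertex discs that meet a ribbon are the orbits of ⟨τ₁ , τ₂⟩, and the
-- boundary components that meet a ribbon are the orbits of ⟨τ₀ , τ₁⟩.
-- Every fixed-point-free involution τ₁ arises from a ribbon graph, unique
-- up to homeomorphism once the number of isolated vertices is given.
record EmbeddedGraph : Set where
  field
    edges         : ℕ
    isolated      : ℕ
    τ₁            : Flag edges → Flag edges
    τ₁-involutive : ∀ x → τ₁ (τ₁ x) ≡ x
    τ₁-fixfree    : ∀ x → τ₁ x ≢ x

open EmbeddedGraph public

-- The corner in position x of a ribbon of the new graph is glued where
-- the corner in position ρ x was glued before.
reglue : (G : EmbeddedGraph) (ρ : Flag (edges G) → Flag (edges G)) →
         (∀ x → ρ (ρ x) ≡ x) → EmbeddedGraph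
reglue G ρ ρρ = record
  { edges         = edges G
  ; isolated      = isolated G
  ; τ₁            = λ x → ρ (τ₁ G (ρ x))
  ; τ₁-involutive = λ x → trans (cong (ρ ∘ τ₁ G) (ρρ _))
                         (trans (cong ρ (τ₁-involutive G _)) (ρρ x))
  ; τ₁-fixfree    = λ x eq → τ₁-fixfree G (ρ x) (trans (sym (ρρ _)) (cong ρ eq))
  }

-- In the dual the free arcs of the vertex discs are kept, and the ends
-- and the sides of every ribbon exchange their roles.  The dual of an
-- isolated vertex (in a sphere) is an isolated vertex.
swapEndSide : ∀ {n} → Flag n → Flag n
swapEndSide (e , a , b) = e , b , a

dual : EmbeddedGraph → EmbeddedGraph
dual G = reglue G swapEndSide (λ _ → refl)

-- A half-twist detaches the end `true` of the ribbon and glues it back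
-- with its two corners exchanged.
halfTwist : ∀ {n} → Subset n → Flag n → Flag n
halfTwist A (e , a , b) = e , a , b xor (a ∧ lookup A e)

xor-xor : ∀ b c → (b xor c) xor c ≡ b
xor-xor false false = refl
xor-xor false true  = refl
xor-xor true  false = refl
xor-xor true  true  = refl

halfTwist-involutive : ∀ {n} (A : Subset n) x → halfTwist A (halfTwist A x) ≡ x
halfTwist-involutive A (e , a , b) = cong (λ c → e , a , c) (xor-xor b (a ∧ lookup A e))

partialPetrial : (G : EmbeddedGraph) → Subset (edges G) → EmbeddedGraph
partialPetrial G A = reglue G (halfTwist A) (halfTwist-involutive A)

petrial : EmbeddedGraph → EmbeddedGraph
petrial G = partialPetrial G ⊤

-- The flags of G correspond to the triangles of the barycentric
-- subdivision of the closed surface (isolated vertices lie in spheres).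
-- Assign to a triangle the orientation in which its corners appear in the
-- order vertex, edge, face, or the opposite one; adjacent triangles
-- x and τᵢ x are coherently oriented iff different choices are made.
Orientable : EmbeddedGraph → Set
Orientable G = Σ[ o ∈ (Flag (edges G) → Bool) ]
  (∀ x → o (τ₀ x) ≢ o x × o (τ₁ G x) ≢ o x × o (τ₂ x) ≢ o x)

------------------------------------------------------------------------
-- Faces

bools : List Bool
bools = false ∷ true ∷ []

flags : ∀ n → List (Flag n)
flags n = cartesianProduct (List.allFin n) (cartesianProduct bools bools)

∈-bools : ∀ b → b ∈ bools
∈-bools false = here refl
∈-bools true  = there (here refl)

∈-flags : ∀ {n} (x : Flag n) → x ∈ flags n
∈-flags (e , a , b) =
  ∈-cartesianProduct⁺ (∈-allFin e) (∈-cartesianProduct⁺ (∈-bools a) (∈-bools b))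

_≟ᶠˡ_ : ∀ {n} → DecidableEquality (Flag n)
_≟ᶠˡ_ = ≡-dec _≟ᶠ_ (≡-dec _≟ᵇ_ _≟ᵇ_)

module _ (G : EmbeddedGraph) where

  FaceStep : Rel (Flag (edges G)) 0ℓ
  FaceStep x y = y ≡ τ₀ x ⊎ y ≡ τ₁ G x

  faceStep? : Decidable FaceStep
  faceStep? x y = (y ≟ᶠˡ τ₀ x) ⊎-dec (y ≟ᶠˡ τ₁ G x)

  -- Symmetric, since τ₀ and τ₁ are involutions.
  SameFace : Rel (Flag (edges G)) 0ℓ
  SameFace = Star FaceStep

  sameFace? : Decidable SameFace
  sameFace? = Reachability.star? _≟ᶠˡ_ (flags (edges G)) ∈-flags faceStep?

  -- The boundary of the disc of an isolated vertex is one boundary component.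
  f : ℕ
  f = length (deduplicate sameFace? (flags (edges G))) + isolated G

------------------------------------------------------------------------
-- The Penrose polynomial

allVecs : ∀ {A : Set} → List A → ∀ n → List (Vec A n)
allVecs xs zero    = [] ∷ []
allVecs xs (suc n) = cartesianProductWith _∷_ xs (allVecs xs n)

allSubsets : ∀ n → List (Subset n)
allSubsets = allVecs (outside ∷ inside ∷ [])

sumℤ : List ℤ → ℤ
sumℤ = foldr _+ℤ_ 0ℤ

P : EmbeddedGraph → ℤ → ℤ
P G x = sumℤ (List.map (λ A → (-1ℤ ^ℤ ∣ A ∣) *ℤ (x ^ℤ f (partialPetrial G A)))
                       (allSubsets (edges G)))

------------------------------------------------------------------------
-- Medial graphs

HalfEdge : ℕ → Set
HalfEdge n = Fin n × Fin 4

-- A checkerboard coloured 4-regular embedded graph.  The half-edges at a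
-- vertex v are (v , 0F), …, (v , 3F) in cyclic order (the h₁, …, h₄ of the
-- usual notation); the corners between 0F and 1F and between 2F and 3F are
-- white, those between 1F and 2F and between 3F and 0F are black.  An edge
-- is either a pair {h , partner h} or a free loop.
record CheckerboardGraph : Set where
  field
    vertices           : ℕ
    freeLoops          : ℕ
    partner            : HalfEdge vertices → HalfEdge vertices
    partner-involutive : ∀ h → partner (partner h) ≡ h
    partner-fixfree    : ∀ h → partner h ≢ h

open CheckerboardGraph public

-- An edge of the medial graph runs close to a free arc of a vertex disc,
-- from the centre of one ribbon to the centre of the next; so the
-- half-edges at the centre of a ribbon point to the corners of that
-- ribbon.  Consecutive corners are separated by a side of the ribbon (a
-- face of G, white) or by an end of the ribbon (a vertex of G, black).
toHalf : ∀ {n} → Flag n → HalfEdge n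
toHalf (e , false , false) = e , 0F
toHalf (e , true  , false) = e , 1F
toHalf (e , true  , true ) = e , 2F
toHalf (e , false , true ) = e , 3F

fromHalf : ∀ {n} → HalfEdge n → Flag n
fromHalf (e , 0F) = e , false , false
fromHalf (e , 1F) = e , true  , false
fromHalf (e , 2F) = e , true  , true
fromHalf (e , 3F) = e , false , true

toHalf-fromHalf : ∀ {n} (h : HalfEdge n) → toHalf (fromHalf h) ≡ h
toHalf-fromHalf (e , 0F) = refl
toHalf-fromHalf (e , 1F) = refl
toHalf-fromHalf (e , 2F) = refl
toHalf-fromHalf (e , 3F) = refl

fromHalf-toHalf : ∀ {n} (x : Flag n) → fromHalf (toHalf x) ≡ x
fromHalf-toHalf (e , false , false) = refl
fromHalf-toHalf (e , true  , false) = refl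
fromHalf-toHalf (e , true  , true ) = refl
fromHalf-toHalf (e , false , true ) = refl

medial : EmbeddedGraph → CheckerboardGraph
medial G = record
  { vertices           = edges G
  ; freeLoops          = isolated G
  ; partner            = λ h → toHalf (τ₁ G (fromHalf h))
  ; partner-involutive = λ h →
      trans (cong (toHalf ∘ τ₁ G) (fromHalf-toHalf _))
     (trans (cong toHalf (τ₁-involutive G _)) (toHalf-fromHalf h))
  ; partner-fixfree    = λ h eq → τ₁-fixfree G (fromHalf h)
      (trans (sym (fromHalf-toHalf _)) (cong fromHalf eq))
  }

------------------------------------------------------------------------
-- k-valuations

module _ {k : ℕ} where

  Total White Crossing : Vec (Fin k) 4 → Set
  Total    (h₁ ∷ h₂ ∷ h₃ ∷ h₄ ∷ []) = h₁ ≡ h₂ × h₂ ≡ h₃ × h₃ ≡ h₄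
  White    (h₁ ∷ h₂ ∷ h₃ ∷ h₄ ∷ []) = h₁ ≡ h₂ × h₃ ≡ h₄ × h₁ ≢ h₃
  Crossing (h₁ ∷ h₂ ∷ h₃ ∷ h₄ ∷ []) = h₁ ≡ h₃ × h₂ ≡ h₄ × h₁ ≢ h₂

  total? : Decidable₁ Total
  total? (h₁ ∷ h₂ ∷ h₃ ∷ h₄ ∷ []) = (h₁ ≟ᶠ h₂) ×-dec (h₂ ≟ᶠ h₃) ×-dec (h₃ ≟ᶠ h₄)

  white? : Decidable₁ White
  white? (h₁ ∷ h₂ ∷ h₃ ∷ h₄ ∷ []) = (h₁ ≟ᶠ h₂) ×-dec (h₃ ≟ᶠ h₄) ×-dec ¬? (h₁ ≟ᶠ h₃)

  crossing? : Decidable₁ Crossing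
  crossing? (h₁ ∷ h₂ ∷ h₃ ∷ h₄ ∷ []) = (h₁ ≟ᶠ h₃) ×-dec (h₂ ≟ᶠ h₄) ×-dec ¬? (h₁ ≟ᶠ h₂)

module _ (M : CheckerboardGraph) (k : ℕ) where

  -- A colour for every half-edge and for every free loop.
  Colouring : Set
  Colouring = Vec (Vec (Fin k) 4) (vertices M) × Vec (Fin k) (freeLoops M)

  allColourings : List Colouring
  allColourings = cartesianProduct
    (allVecs (allVecs (List.allFin k) 4) (vertices M))
    (allVecs (List.allFin k) (freeLoops M))

  colour : Colouring → HalfEdge (vertices M) → Fin k
  colour φ (v , i) = lookup (lookup (proj₁ φ) v) i

  -- The first condition says that φ is a colouring of the edges.
  Valuation : Colouring → Set
  Valuation φ =
    (∀ v i → colour φ (partner M (v , i)) ≡ colour φ (v , i)) ×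
    (∀ v c → 2 ∣ Vec.count (_≟ᶠ c) (lookup (proj₁ φ) v))

  valuation? : Decidable₁ Valuation
  valuation? φ =
    all? (λ v → all? λ i → colour φ (partner M (v , i)) ≟ᶠ colour φ (v , i)) ×-dec
    all? (λ v → all? λ c → 2 ∣? Vec.count (_≟ᶠ c) (lookup (proj₁ φ) v))

  Permissible : Colouring → Set
  Permissible φ = ∀ v → let hs = lookup (proj₁ φ) v in White hs ⊎ Crossing hs ⊎ Total hs

  permissible? : Decidable₁ Permissible
  permissible? φ = all? λ v → let hs = lookup (proj₁ φ) v in
    white? hs ⊎-dec crossing? hs ⊎-dec total? hs

  tot : Colouring → ℕ
  tot φ = Vec.count total? (proj₁ φ)

  -- The set 𝒫(M , k), each element listed once.
  permissibleValuations : List Colouring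
  permissibleValuations =
    filter (λ φ → valuation? φ ×-dec permissible? φ) allColourings

{-# OPTIONS --safe #-}
module Submission where

-- Orientability of G^{*×} amounts to directing the edges of the medial graph so
-- that at every vertex the two corners of a ribbon at one end point in and those
-- at the other end point out.  The boundary components of G^{τ(A)} are then
-- directed circuits.  Cut a ribbon e: the circuits through e become two arcs,
-- each running from one end of e to the other.  The two ways of reconnecting
-- them give one circuit and two circuits respectively, so (-1)^{|A| + f(G^{τ(A)})}
-- does not depend on A.  Finally k^{f(G^{τ(A)})} counts the colourings of the
-- medial edges that are constant on these circuits, and a colouring is constant
-- on the circuits of exactly 2^tot sets A if it is permissible and of none otherwise.

open import Defs
open import Data.Integer using (+_; -_; -1ℤ; _*_; _^_)
open import Data.List using (map)
open import Data.Nat.ListAction using (sum)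
open import Data.Nat using (ℕ; NonZero) renaming (_^_ to _^ℕ_)
open import Relation.Binary.PropositionalEquality using (_≡_)
open import Data.Bool using (Bool; true; false; not; _∧_; _xor_; if_then_else_)
open import Data.Bool.Properties
  using (¬-not; not-involutive; ∧-identityʳ; xor-same; not-distribˡ-xor; not-distribʳ-xor)
  renaming (_≟_ to _≟ᵇ_)
open import Data.Fin using (Fin; zero; suc; toℕ; punchIn; punchOut)
open import Data.Fin.Patterns using (0F; 1F; 2F; 3F)
open import Data.Fin.Properties
  using (all?; injective⇒≤; pigeonhole; punchIn-injective; punchInᵢ≢i; punchIn-punchOut)
  renaming (_≟_ to _≟ᶠ_)
open import Data.Fin.Subset using (Subset; inside; outside; ⊥; ⊤; ∣_∣)
open import Data.Fin.Subset.Properties using (∣⊥∣≡0)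
open import Data.Integer using (ℤ) renaming (_+_ to _+ℤ_)
open import Data.Integer.Properties as ℤₚ using ()
open import Data.Integer.Tactic.RingSolver using () renaming (solve-∀ to solveℤ-∀)
open import Data.List as List
  using (List; []; _∷_; _++_; length; filter; deduplicate; cartesianProduct; cartesianProductWith)
open import Data.List.Membership.Propositional using (_∈_)
open import Data.List.Membership.Propositional.Properties
  using (∈-lookup; ∈-allFin; ∈-cartesianProduct⁺; ∈-cartesianProductWith⁺;
         ∈-filter⁺; ∈-filter⁻; ∈-map⁺; ∈-map⁻)
open import Data.List.Membership.Propositional.Properties.WithK using (unique∧set⇒bag)
open import Data.List.Properties
  using (map-cong; map-∘; map-++; ++-identityʳ; length-map; length-++; length-tabulate)
open import Data.List.Relation.Binary.BagAndSetEquality using (∼bag⇒↭)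
open import Data.List.Relation.Binary.Permutation.Propositional.Properties using (↭-length)
open import Data.List.Relation.Unary.All as All using ([])
open import Data.List.Relation.Unary.AllPairs using (AllPairs; []; _∷_)
open import Data.List.Relation.Unary.Any as Any using (here)
open import Data.List.Relation.Unary.Any.Properties using (lookup-index; deduplicate⁺)
open import Data.List.Relation.Unary.Unique.DecSetoid.Properties using (deduplicate-!)
open import Data.List.Relation.Unary.Unique.Propositional using (Unique)
open import Data.List.Relation.Unary.Unique.Propositional.Properties as Uniqueₚ using (allFin⁺)
open import Data.Maybe using (Maybe; just; nothing)
open import Data.Nat using (zero; suc; _+_; _≤_; _<_; s≤s; z≤n) renaming (_*_ to _*ℕ_)
open import Data.Nat.Divisibility using (_∣_; divides)
open import Data.Nat.GeneralisedArithmetic using (fold; fold-+)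
open import Data.Nat.Induction using (<-wellFounded; Acc; acc)
open import Data.Nat.ListAction.Properties using (sum-++)
open import Data.Nat.Properties as ℕₚ
  using (≤-antisym; ≤-total; m≤n⇒∃[o]m+o≡n; +-suc; m<n+m; m<m+n; n<1+n)
open import Data.Nat.Tactic.RingSolver using (solve-∀)
open import Data.Product using (∃; ∃-syntax; _×_; _,_; proj₁; proj₂; uncurry)
open import Data.Sum using (_⊎_; inj₁; inj₂; [_,_]′)
open import Data.Vec as Vec using (Vec; []; _∷_; lookup; tabulate; _[_]≔_)
open import Data.Vec.Properties
  using (lookup∘update; lookup∘update′; lookup-replicate; []≔-lookup;
         lookup∘tabulate; tabulate∘lookup; tabulate-cong; ∷-injective)
open import Function using (_∘_; id; mk⇔)
open import Level using (0ℓ)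
open import Relation.Binary using (Rel; Decidable; IsEquivalence)
open import Relation.Binary.Construct.Closure.ReflexiveTransitive
  using (Star; ε; _◅_; _◅◅_; reverse; return; gmap; _⋆)
open import Relation.Binary.PropositionalEquality
open import Relation.Nullary using (¬_; Dec; yes; no; contradiction; does; _×-dec_; _⊎-dec_)
open import Relation.Nullary.Decidable using (dec-true; dec-false)
open import Relation.Unary using () renaming (Decidable to Decidable₁)

-- Transversals

-- Cutting a ribbon leaves the class of ribbon graphs. The cut is therefore modelled on the flags of
-- the uncut graph: the involution that crosses ribbons is allowed to fix the four corners of the
-- cut ribbon. An arc is then an orbit containing fixed points, and the claims about arcs become
-- claims about two involutions: an orbit has at most two fixed points of `ρ`, and a walk starting
-- at one must stop at another where the direction is reversed. The direction depends only on the
-- end of a ribbon and not on the side, so one function `o` serves all sets of half-twists at once.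
-- No face number is ever computed. A `Transversal` expresses that a relation has `m` classes
-- independently of any enumeration, so the cut and its two reconnections can be compared by moving
-- representatives from one relation to another.

record Transversal {A : Set} (_∼_ : Rel A 0ℓ) (m : ℕ) : Set where
  field
    rep       : Fin m → A
    covers    : ∀ x → ∃[ i ] x ∼ rep i
    separated : ∀ {i j} → rep i ∼ rep j → i ≡ j

  index : A → Fin m
  index = proj₁ ∘ covers

  ∼-index : ∀ x → x ∼ rep (index x)
  ∼-index = proj₂ ∘ covers

open Transversal

module _ {A : Set} {_∼_ : Rel A 0ℓ} (equiv : IsEquivalence _∼_) where
  private module E = IsEquivalence equiv

  index-cong : ∀ {m} (T : Transversal _∼_ m) {x y} → x ∼ y → index T x ≡ index T y
  index-cong T x∼y =
    separated T (E.trans (E.sym (∼-index T _)) (E.trans x∼y (∼-index T _)))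

  index-rep : ∀ {m} (T : Transversal _∼_ m) i → index T (rep T i) ≡ i
  index-rep T i = separated T (E.sym (∼-index T _))

  transversal-≤ : ∀ {m n} → Transversal _∼_ m → Transversal _∼_ n → m ≤ n
  transversal-≤ S T = injective⇒≤ {f = index T ∘ rep S} λ {i} {j} eq → separated S
    (E.trans (∼-index T _)
      (E.trans (E.reflexive (cong (rep T) eq)) (E.sym (∼-index T _))))

  transversal-size : ∀ {m n} → Transversal _∼_ m → Transversal _∼_ n → m ≡ n
  transversal-size S T = ≤-antisym (transversal-≤ S T) (transversal-≤ T S)

  separatedList : ∀ {xs} → AllPairs (λ x y → ¬ x ∼ y) xs → ∀ i j →
                  List.lookup xs i ∼ List.lookup xs j → i ≡ j
  separatedList {_ ∷ _} _         zero    zero    _   = refl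
  separatedList {_ ∷ _} (x≁ ∷ _)  zero    (suc j) x∼y =
    contradiction x∼y (All.lookup x≁ (∈-lookup j))
  separatedList {_ ∷ _} (x≁ ∷ _)  (suc i) zero    x∼y =
    contradiction (E.sym x∼y) (All.lookup x≁ (∈-lookup i))
  separatedList {_ ∷ _} (_ ∷ xs!) (suc i) (suc j) x∼y =
    cong suc (separatedList xs! i j x∼y)

  -- The bridge to `f`, which is defined through the length of a deduplicated list.
  deduplicateTransversal : (_∼?_ : Decidable _∼_) (xs : List A) → (∀ x → x ∈ xs) →
                           Transversal _∼_ (length (deduplicate _∼?_ xs))
  deduplicateTransversal _∼?_ xs complete = record
    { rep       = List.lookup ds
    ; covers    = λ x →
        let x∈ds = deduplicate⁺ _∼?_ (λ y∼z x∼z → E.trans x∼z (E.sym y∼z))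
                     (Any.map E.reflexive (complete x))
        in Any.index x∈ds , lookup-index x∈ds
    ; separated = separatedList
        (deduplicate-! record { isDecEquivalence = record { isEquivalence = equiv ; _≟_ = _∼?_ } } xs)
        _ _
    }
    where ds = deduplicate _∼?_ xs

module _ {A B : Set} {_∼_ : Rel A 0ℓ} {_≈_ : Rel B 0ℓ} (to : A → B) (from : B → A)
         (inverse : ∀ y → to (from y) ≡ y)
         (preserves : ∀ {x y} → x ∼ y → to x ≈ to y)
         (reflects : ∀ {x y} → to x ≈ to y → x ∼ y) where

  transport : ∀ {m} → Transversal _∼_ m → Transversal _≈_ m
  transport T = record
    { rep       = to ∘ rep T
    ; covers    = λ y → index T (from y) ,
        subst (_≈ to (rep T (index T (from y)))) (inverse y) (preserves (∼-index T (from y)))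
    ; separated = separated T ∘ reflects
    }

-- The equivalence generated by `_∼_` and the pair `x`, `y`, written without a closure: two uses of
-- the pair in the same direction shorten to one, and two in opposite directions cancel.
Merged : {A : Set} → Rel A 0ℓ → A → A → Rel A 0ℓ
Merged _∼_ x y u v = u ∼ v ⊎ (u ∼ x × y ∼ v) ⊎ (u ∼ y × x ∼ v)

module _ {A : Set} {_∼_ : Rel A 0ℓ} (equiv : IsEquivalence _∼_) where
  private module E = IsEquivalence equiv

  merged-sym : ∀ {x y u v} → Merged _∼_ x y u v → Merged _∼_ x y v u
  merged-sym (inj₁ p)              = inj₁ (E.sym p)
  merged-sym (inj₂ (inj₁ (p , q))) = inj₂ (inj₂ (E.sym q , E.sym p))
  merged-sym (inj₂ (inj₂ (p , q))) = inj₂ (inj₁ (E.sym q , E.sym p))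

  merged-trans : ∀ {x y u v w} → Merged _∼_ x y u v → Merged _∼_ x y v w → Merged _∼_ x y u w
  merged-trans (inj₁ p)              (inj₁ q)              = inj₁ (E.trans p q)
  merged-trans (inj₁ p)              (inj₂ (inj₁ (q , r))) = inj₂ (inj₁ (E.trans p q , r))
  merged-trans (inj₁ p)              (inj₂ (inj₂ (q , r))) = inj₂ (inj₂ (E.trans p q , r))
  merged-trans (inj₂ (inj₁ (p , q))) (inj₁ r)              = inj₂ (inj₁ (p , E.trans q r))
  merged-trans (inj₂ (inj₂ (p , q))) (inj₁ r)              = inj₂ (inj₂ (p , E.trans q r))
  merged-trans (inj₂ (inj₁ (p , _))) (inj₂ (inj₁ (_ , r))) = inj₂ (inj₁ (p , r))
  merged-trans (inj₂ (inj₁ (p , _))) (inj₂ (inj₂ (_ , r))) = inj₁ (E.trans p r)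
  merged-trans (inj₂ (inj₂ (p , _))) (inj₂ (inj₁ (_ , r))) = inj₁ (E.trans p r)
  merged-trans (inj₂ (inj₂ (p , _))) (inj₂ (inj₂ (_ , r))) = inj₂ (inj₂ (p , r))

  module _ {_≈_ : Rel A 0ℓ} {x y} (≈-trans : ∀ {u v w} → u ≈ v → v ≈ w → u ≈ w)
           (∼⇒≈ : ∀ {u v} → u ∼ v → u ≈ v) (y≈x : y ≈ x)
           (≈⇒merged : ∀ {u v} → u ≈ v → Merged _∼_ x y u v)
           (x≁y : ¬ x ∼ y) where

    -- The representative of the class of `y` is dropped, and that of `x`, which survives because
    -- `x` and `y` were unrelated, takes over its class. No remaining representative is related to
    -- `y`, so the two new cases of `Merged` cannot identify any of them.
    mergeTransversal : ∀ {n} → Transversal _∼_ n → ∃[ m ] n ≡ suc m × Transversal _≈_ m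
    mergeTransversal {zero} T with () ← index T x
    mergeTransversal {suc m} T = m , refl , record
      { rep       = rep′
      ; covers    = covers′
      ; separated = λ {i} {j} → separated′ i j ∘ ≈⇒merged
      }
      where
      rep′ : Fin m → A
      rep′ = rep T ∘ punchIn (index T y)

      covers-outside : ∀ {z} → ¬ index T y ≡ index T z → ∃[ i ] z ≈ rep′ i
      covers-outside {z} ≢ = punchOut ≢ , ∼⇒≈ (subst (λ i → z ∼ rep T i)
        (sym (punchIn-punchOut ≢)) (∼-index T z))

      y≢x : ¬ index T y ≡ index T x
      y≢x eq = x≁y (E.trans (∼-index T x)
        (E.trans (E.reflexive (cong (rep T) (sym eq))) (E.sym (∼-index T y))))

      covers′ : ∀ z → ∃[ i ] z ≈ rep′ i
      covers′ z with index T y ≟ᶠ index T z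
      ... | no ≢   = covers-outside ≢
      ... | yes eq =
        let i , x≈i = covers-outside y≢x
            z∼y     = E.trans (∼-index T z)
              (E.trans (E.reflexive (cong (rep T) (sym eq))) (E.sym (∼-index T y)))
        in i , ≈-trans (∼⇒≈ z∼y) (≈-trans y≈x x≈i)

      notLost : ∀ i → ¬ rep′ i ∼ y
      notLost i i∼y = punchInᵢ≢i (index T y) i (separated T (E.trans i∼y (∼-index T y)))

      separated′ : ∀ i j → Merged _∼_ x y (rep′ i) (rep′ j) → i ≡ j
      separated′ i j (inj₁ i∼j)              = punchIn-injective _ i j (separated T i∼j)
      separated′ i j (inj₂ (inj₁ (_ , y∼j))) = contradiction (E.sym y∼j) (notLost j)
      separated′ i j (inj₂ (inj₂ (i∼y , _))) = contradiction i∼y (notLost i)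

-- Orbits of a pair of involutions

module _ {X : Set} (ρ τ : X → X) where

  -- `SameFace H` unfolds to `Orbit τ₀ (τ₁ H)`, so what follows applies to faces directly. Fixed
  -- points of `ρ` are allowed and will be the loose ends of arcs.
  Step : Rel X 0ℓ
  Step x y = y ≡ ρ x ⊎ y ≡ τ x

  Orbit : Rel X 0ℓ
  Orbit = Star Step

fold-suc : ∀ {A : Set} (s : A → A) z n → fold (s z) s n ≡ s (fold z s n)
fold-suc s z zero    = refl
fold-suc s z (suc n) = cong s (fold-suc s z n)

module _ {X : Set} (ρ τ : X → X) (ρρ : ∀ x → ρ (ρ x) ≡ x) (ττ : ∀ x → τ (τ x) ≡ x) where

  step-sym : ∀ {x y} → Step ρ τ x y → Step ρ τ y x
  step-sym (inj₁ refl) = inj₁ (sym (ρρ _))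
  step-sym (inj₂ refl) = inj₂ (sym (ττ _))

  orbit-isEquivalence : IsEquivalence (Orbit ρ τ)
  orbit-isEquivalence = record
    { refl = ε ; sym = reverse step-sym ; trans = _◅◅_ }

  private
    r : X → X
    r = ρ ∘ τ

    r-injective : ∀ {x y} → r x ≡ r y → x ≡ y
    r-injective {x} {y} eq = trans (sym (ττ x))
      (trans (cong τ (trans (sym (ρρ _)) (trans (cong ρ eq) (ρρ _)))) (ττ y))

    -- The dihedral relation: conjugation by `ρ` inverts the rotation `r`.
    reflect : ∀ z i → fold (ρ (fold z r i)) r i ≡ ρ z
    reflect z zero    = refl
    reflect z (suc i) = begin
      r (fold (ρ (r w)) r i) ≡⟨ cong (λ u → r (fold u r i)) (ρρ (τ w)) ⟩
      r (fold (τ w) r i)     ≡⟨ fold-suc r (τ w) i ⟨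
      fold (r (τ w)) r i     ≡⟨ cong (λ u → fold (ρ u) r i) (ττ w) ⟩
      fold (ρ w) r i         ≡⟨ reflect z i ⟩
      ρ z                    ∎
      where open ≡-Reasoning
            w = fold z r i

    -- The points met on applying `τ`, `ρ`, `τ`, ... to `x`. If `ρ` fixes `x`, the walk has no other
    -- direction to start in, so natural exponents already reach the whole orbit.
    OnWalk : X → X → Set
    OnWalk x z = ∃[ i ] (z ≡ fold x r i ⊎ z ≡ τ (fold x r i))

    onWalk-step : ∀ {x z w} → ρ x ≡ x → OnWalk x z → Step ρ τ z w → OnWalk x w
    onWalk-step fx (zero , inj₁ refl)  (inj₁ refl) = zero , inj₁ fx
    onWalk-step fx (suc i , inj₁ refl) (inj₁ refl) = i , inj₂ (ρρ _)
    onWalk-step fx (i , inj₂ refl)     (inj₁ refl) = suc i , inj₁ refl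
    onWalk-step fx (i , inj₁ refl)     (inj₂ refl) = i , inj₂ refl
    onWalk-step fx (i , inj₂ refl)     (inj₂ refl) = i , inj₁ (ττ _)

    onWalk-orbit : ∀ {x z w} → ρ x ≡ x → OnWalk x z → Orbit ρ τ z w → OnWalk x w
    onWalk-orbit fx p ε       = p
    onWalk-orbit fx p (s ◅ q) = onWalk-orbit fx (onWalk-step fx p s) q

    return-power : ∀ {x} → ρ x ≡ x → ∀ i → ρ (fold x r i) ≡ fold x r i →
                   fold x r (i + i) ≡ x
    return-power {x} fx i fy = begin
      fold x r (i + i)          ≡⟨ fold-+ x r i ⟩
      fold (fold x r i) r i     ≡⟨ cong (λ u → fold u r i) fy ⟨
      fold (ρ (fold x r i)) r i ≡⟨ reflect x i ⟩
      ρ x                       ≡⟨ fx ⟩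
      x                         ∎
      where open ≡-Reasoning

    fixedPoint-power : ∀ {x y} → ρ x ≡ x → ρ y ≡ y → Orbit ρ τ x y →
                       ∃[ i ] y ≡ fold x r i × fold x r (i + i) ≡ x
    fixedPoint-power fx fy p with onWalk-orbit fx (zero , inj₁ refl) p
    ... | i , inj₁ refl = i , refl , return-power fx i fy
    -- Here the point is `τ` of the `i`-th power; being fixed by `ρ`, it equals the next power.
    ... | i , inj₂ refl =
      suc i , sym fy , return-power fx (suc i) (trans (ρρ _) (sym fy))

    -- If 2i and 2j are both periods of `x` under `r`, then modulo the least period d each of 0, i
    -- and j is 0 or d/2, so two of them agree. The descent below reaches this conclusion without a
    -- least period, by replacing the larger of i and j with their difference.
    Half : X → ℕ → ℕ → Set
    Half x i j = x ≡ fold x r i ⊎ x ≡ fold x r j ⊎ fold x r i ≡ fold x r j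

    half-sym : ∀ {x} i j → Half x i j → Half x j i
    half-sym i j (inj₁ p)        = inj₂ (inj₁ p)
    half-sym i j (inj₂ (inj₁ p)) = inj₁ p
    half-sym i j (inj₂ (inj₂ p)) = inj₂ (inj₂ (sym p))

    power-∸ : ∀ {x} i d → fold x r (i + i) ≡ x →
              fold x r ((i + d) + (i + d)) ≡ x → fold x r (d + d) ≡ x
    power-∸ {x} i d pᵢ pⱼ = begin
      fold x r (d + d)                  ≡⟨ cong (λ u → fold u r (d + d)) pᵢ ⟨
      fold (fold x r (i + i)) r (d + d) ≡⟨ fold-+ x r (d + d) ⟨
      fold x r ((d + d) + (i + i))      ≡⟨ cong (fold x r) (rearrange i d) ⟨
      fold x r ((i + d) + (i + d))      ≡⟨ pⱼ ⟩
      x                                 ∎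
      where
      open ≡-Reasoning
      rearrange : ∀ a b → (a + b) + (a + b) ≡ (b + b) + (a + a)
      rearrange = solve-∀

    half-+ : ∀ {x} i d → fold x r (i + i) ≡ x → Half x i d → Half x i (i + d)
    half-+ i d pᵢ (inj₁ p) = inj₁ p
    half-+ {x} i d pᵢ (inj₂ (inj₁ p)) =
      inj₂ (inj₂ (trans (cong (λ u → fold u r i) p) (sym (fold-+ x r i))))
    half-+ {x} i d pᵢ (inj₂ (inj₂ p)) = inj₂ (inj₁ (sym (begin
      fold x r (i + d)      ≡⟨ fold-+ x r i ⟩
      fold (fold x r d) r i ≡⟨ cong (λ u → fold u r i) p ⟨
      fold (fold x r i) r i ≡⟨ fold-+ x r i ⟨
      fold x r (i + i)      ≡⟨ pᵢ ⟩
      x                     ∎)))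
      where open ≡-Reasoning

    -- Euclid's algorithm on (i , j).
    halfPeriods : ∀ {x} i j → Acc _<_ (i + j) →
                  fold x r (i + i) ≡ x → fold x r (j + j) ≡ x → Half x i j
    halfPeriods zero    j       _ _ _ = inj₁ refl
    halfPeriods (suc i) zero    _ _ _ = inj₂ (inj₁ refl)
    halfPeriods i@(suc _) j@(suc _) (acc smaller) pᵢ pⱼ with ≤-total i j
    ... | inj₁ i≤j with d , refl ← m≤n⇒∃[o]m+o≡n i≤j =
      half-+ i d pᵢ (halfPeriods i d (smaller (m<n+m (i + d) (s≤s z≤n))) pᵢ (power-∸ i d pᵢ pⱼ))
    ... | inj₂ j≤i with d , refl ← m≤n⇒∃[o]m+o≡n j≤i =
      half-sym j (j + d) (half-+ j d pⱼ
        (halfPeriods j d (smaller (m<m+n (j + d) (s≤s z≤n))) pⱼ (power-∸ j d pⱼ pᵢ)))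

  -- An arc has no third end. This is what keeps apart the arcs that leave the two corners of one
  -- end of the cut ribbon.
  twoFixedPoints : ∀ {x y z} → ρ x ≡ x → ρ y ≡ y → ρ z ≡ z →
                   Orbit ρ τ x y → Orbit ρ τ x z → x ≡ y ⊎ x ≡ z ⊎ y ≡ z
  twoFixedPoints fx fy fz x∼y x∼z
    with i , refl , pᵢ ← fixedPoint-power fx fy x∼y
       | j , refl , pⱼ ← fixedPoint-power fx fz x∼z
    = halfPeriods i j (<-wellFounded _) pᵢ pⱼ

  module _ (xs : List X) (complete : ∀ x → x ∈ xs) where

    private
      fold-cancel : ∀ {x} i d → fold x r i ≡ fold x r (i + d) → x ≡ fold x r d
      fold-cancel zero    d eq = eq
      fold-cancel (suc i) d eq = fold-cancel i d (r-injective eq)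

      periodic : ∀ x → ∃[ d ] fold x r (suc d) ≡ x
      periodic x
        with i , j , i<j , eq ← pigeonhole (n<1+n (length xs))
               (λ i → Any.index (complete (fold x r (toℕ i))))
        with d , i+d≡j ← m≤n⇒∃[o]m+o≡n i<j
        = d , sym (fold-cancel (toℕ i) (suc d) (begin
          fold x r (toℕ i)           ≡⟨ lookup-index (complete _) ⟩
          List.lookup xs _           ≡⟨ cong (List.lookup xs) eq ⟩
          List.lookup xs _           ≡⟨ lookup-index (complete _) ⟨
          fold x r (toℕ j)           ≡⟨ cong (fold x r) (trans (+-suc (toℕ i) d) i+d≡j) ⟨
          fold x r (toℕ i + suc d)   ∎))
        where open ≡-Reasoning

    module _ (o : X → Bool) (oτ : ∀ x → o (τ x) ≢ o x)
             (oρ : ∀ x → ρ x ≡ x ⊎ o (ρ x) ≢ o x) where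

      -- Walk from `x` by `τ` and `ρ` in turn. Each `τ` reverses `o`, and each `ρ` that moves its
      -- point reverses it back, so wherever `ρ` first stops the walk the value is opposite to that
      -- at `x`. Periodicity bounds the walk.
      oppositeFixedPoint : ∀ {x} → ρ x ≡ x →
                           ∃[ y ] ρ y ≡ y × Orbit ρ τ x y × o y ≢ o x
      oppositeFixedPoint {x} fx = [ id , closes ]′ (explore d)
        where
        d = proj₁ (periodic x)

        Found : Set
        Found = ∃[ y ] ρ y ≡ y × Orbit ρ τ x y × o y ≢ o x

        Onward : ℕ → Set
        Onward i = Orbit ρ τ x (fold x r i) × o (fold x r i) ≡ o x

        explore : ∀ i → Found ⊎ Onward i
        explore zero    = inj₂ (ε , refl)
        explore (suc i) with explore i
        ... | inj₁ found = inj₁ found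
        ... | inj₂ (p , oᵢ) with oρ (τ (fold x r i))
        ...   | inj₁ fixed = inj₁ (τ (fold x r i) , fixed , p ◅◅ return (inj₂ refl)
                                  , λ eq → oτ _ (trans eq (sym oᵢ)))
        ...   | inj₂ flip  = inj₂ (p ◅◅ inj₂ refl ◅ inj₁ refl ◅ ε , (begin
          o (r (fold x r i))       ≡⟨ ¬-not flip ⟩
          not (o (τ (fold x r i))) ≡⟨ cong not (¬-not (oτ _)) ⟩
          not (not (o (fold x r i))) ≡⟨ not-involutive _ ⟩
          o (fold x r i)           ≡⟨ oᵢ ⟩
          o x                      ∎))
          where open ≡-Reasoning

        -- After a full turn the point returned is `x` itself, by `last`, yet with the value
        -- opposite to its own. The case is contradictory, but it supplies everything that `Found`
        -- asks for, so no separate refutation is made.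
        closes : Onward d → Found
        closes (p , o≡) = τ (fold x r d) , trans (cong ρ last) (trans fx (sym last))
                        , p ◅◅ return (inj₂ refl) , λ eq → oτ _ (trans eq (sym o≡))
          where
          last : τ (fold x r d) ≡ x
          last = trans (sym (ρρ _)) (trans (cong ρ (proj₂ (periodic x))) fx)

-- Smoothings of the vertices of the medial graph

turn : Maybe Bool → Bool × Bool → Bool × Bool
turn nothing  p       = p
turn (just t) (a , b) = not a , b xor t

-- Follow the boundary across the ribbon v, which is untwisted (just false),
-- twisted (just true) or cut into two ends with nothing between them (nothing).
across : ∀ {n} → (Fin n → Maybe Bool) → Flag n → Flag n
across μ (v , p) = v , turn (μ v) p

turn-involutive : ∀ t p → turn t (turn t p) ≡ p
turn-involutive nothing  p       = refl
turn-involutive (just t) (a , b) = cong₂ _,_ (not-involutive a) (xor-xor b t)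

across-involutive : ∀ {n} (μ : Fin n → Maybe Bool) x → across μ (across μ x) ≡ x
across-involutive μ (v , p) = cong (v ,_) (turn-involutive (μ v) p)

τ₀-involutive : ∀ {n} (x : Flag n) → τ₀ (τ₀ x) ≡ x
τ₀-involutive (e , a , b) = cong (λ c → e , c , b) (not-involutive a)

uncut : ∀ {n} → (Fin n → Bool) → Flag n → Flag n
uncut α = across (just ∘ α)

module _ (G : EmbeddedGraph) where

  private
    n = edges G
    τ = τ₁ G

  Faces : (Fin n → Bool) → Flag n → Flag n → Set
  Faces α = Orbit (uncut α) τ

  faces-isEquivalence : ∀ α → IsEquivalence (Faces α)
  faces-isEquivalence α =
    orbit-isEquivalence (uncut α) τ (across-involutive (just ∘ α)) (τ₁-involutive G)

  module _ (A : Subset n) where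
    private
      h = halfTwist A
      GA = partialPetrial G A

    -- Conjugation by h moves the half-twists from τ₁ into τ₀, so that τ₁ does not
    -- depend on A any more.
    halfTwist-τ₀ : ∀ x → h (τ₀ x) ≡ uncut (lookup A) (h x)
    halfTwist-τ₀ (e , a , b) = cong (λ c → e , not a , c) (lemma a b (lookup A e))
      where
      lemma : ∀ a b t → b xor (not a ∧ t) ≡ (b xor (a ∧ t)) xor t
      lemma false false t     = refl
      lemma false true  t     = refl
      lemma true  false false = refl
      lemma true  true  false = refl
      lemma true  false true  = refl
      lemma true  true  true  = refl

    sameFace⇒faces : ∀ {x y} → SameFace GA x y → Faces (lookup A) (h x) (h y)
    sameFace⇒faces = gmap h λ {x} → λ where
      (inj₁ refl) → inj₁ (halfTwist-τ₀ x)
      (inj₂ refl) → inj₂ (halfTwist-involutive A _)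

    faces⇒sameFace : ∀ {x y} → Faces (lookup A) x y → SameFace GA (h x) (h y)
    faces⇒sameFace = gmap h λ {x} → λ where
      (inj₁ refl) → inj₁ (trans
        (cong (h ∘ uncut (lookup A)) (sym (halfTwist-involutive A x)))
        (trans (cong h (sym (halfTwist-τ₀ (h x)))) (halfTwist-involutive A _)))
      (inj₂ refl) → inj₂ (cong (h ∘ τ) (sym (halfTwist-involutive A x)))

    sameFace-isEquivalence : IsEquivalence (SameFace GA)
    sameFace-isEquivalence = orbit-isEquivalence τ₀ (τ₁ GA) τ₀-involutive (τ₁-involutive GA)

    -- `f GA` unfolds to this number plus `isolated G`.
    boundaries : ℕ
    boundaries = length (deduplicate (sameFace? GA) (flags n))

    boundaryTransversal : Transversal (Faces (lookup A)) boundaries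
    boundaryTransversal =
      transport h h (halfTwist-involutive A) sameFace⇒faces
        (λ {x} {y} p → subst₂ (SameFace GA) (halfTwist-involutive A x)
                         (halfTwist-involutive A y) (faces⇒sameFace p))
        (deduplicateTransversal sameFace-isEquivalence (sameFace? GA) (flags n) ∈-flags)

  -- The two arcs left by cutting one ribbon

  module _ (o : Flag n → Bool) (oτ : ∀ x → o (τ x) ≢ o x)
           (oτ₀ : ∀ x → o (τ₀ x) ≢ o x)
           (oEnd : ∀ v a b b′ → o (v , a , b) ≡ o (v , a , b′))
           (e : Fin n) (μ : Fin n → Maybe Bool) (cut : μ e ≡ nothing)
           (elsewhere : ∀ v → v ≢ e → ∃[ t ] μ v ≡ just t) where

    private
      R = Orbit (across μ) τ
      equiv : IsEquivalence R
      equiv = orbit-isEquivalence (across μ) τ (across-involutive μ) (τ₁-involutive G)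
      module R = IsEquivalence equiv

    -- Crossing a ribbon changes the end, and a half-twist affects only the side, which `o` does not
    -- see.
    uncut-flips : ∀ α x → o (uncut α x) ≢ o x
    uncut-flips α x@(v , a , b) eq = oτ₀ x (trans (oEnd v (not a) b _) eq)

    cut-fixed : ∀ p → across μ (e , p) ≡ (e , p)
    cut-fixed p = cong (λ t → e , turn t p) cut

    across-flips : ∀ x → across μ x ≡ x ⊎ o (across μ x) ≢ o x
    across-flips (v , p) with v ≟ᶠ e
    ... | yes refl = inj₁ (cut-fixed p)
    ... | no v≢e with t , eq ← elsewhere v v≢e =
      inj₂ (subst (λ u → o (v , turn u p) ≢ o (v , p)) (sym eq) (uncut-flips (λ _ → t) (v , p)))

    fixed-at-cut : ∀ x → across μ x ≡ x → proj₁ x ≡ e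
    fixed-at-cut (v , p) fixed with v ≟ᶠ e
    ... | yes v≡e = v≡e
    ... | no v≢e with t , eq ← elsewhere v v≢e =
      contradiction (cong o (trans (cong (λ u → v , turn u p) (sym eq)) fixed))
                    (uncut-flips (λ _ → t) (v , p))

    -- The arc starting at this corner stops at a fixed point, and fixed points occur only at `e`.
    -- There `o` has the opposite value, which by `oEnd` forces the other end of the ribbon.
    mate : ∀ a b → ∃[ b′ ] R (e , a , b) (e , not a , b′)
    mate a b with oppositeFixedPoint (across μ) τ (across-involutive μ) (τ₁-involutive G)
                    (flags n) ∈-flags o oτ across-flips (cut-fixed (a , b))
    ... | (v , a′ , b′) , fixed , path , opposite
      with refl ← fixed-at-cut (v , a′ , b′) fixed
      = b′ , subst (λ c → R (e , a , b) (e , c , b′))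
               (¬-not λ where refl → opposite (oEnd e a b′ b)) path

    -- The bit `t` records which corners the two arcs join. A ribbon with twist `t` put back at `e`
    -- closes each arc on itself; twist `not t` joins the two arcs into one circuit.
    pairing : ∃[ t ] R (e , false , false) (e , true , t) ×
                     R (e , false , true) (e , true , not t) ×
                     ¬ R (e , false , false) (e , false , true)
    pairing with s , p ← mate false false | t , q ← mate false true =
      s , p , subst (λ u → R (e , false , true) (e , true , u)) (¬-not t≢s) q , apart
      where
      -- Otherwise one orbit would contain three distinct fixed points: both corners at the end
      -- `false` and a mate at the end `true`.
      apart : ¬ R (e , false , false) (e , false , true)
      apart path with twoFixedPoints (across μ) τ (across-involutive μ) (τ₁-involutive G)
                        (cut-fixed _) (cut-fixed _) (cut-fixed _) p path
      ... | inj₁ ()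
      ... | inj₂ (inj₁ ())
      ... | inj₂ (inj₂ ())
      t≢s : t ≢ s
      t≢s refl = apart (R.trans p (R.sym q))

    module _ (α : Fin n → Bool) (agree : ∀ v → v ≢ e → μ v ≡ just (α v)) where

      cut⇒faces : ∀ {x y} → R x y → Faces α x y
      cut⇒faces = step ⋆
        where
        step : ∀ {x y} → Step (across μ) τ x y → Faces α x y
        step {v , p} (inj₁ refl) with v ≟ᶠ e
        ... | yes refl = subst (Faces α (e , p)) (sym (cut-fixed p)) ε
        ... | no v≢e   = return (inj₁ (cong (λ t → v , turn t p) (agree v v≢e)))
        step (inj₂ refl) = return (inj₂ refl)

      step-elsewhere : ∀ {v p y} → v ≢ e → Step (uncut α) τ (v , p) y → R (v , p) y
      step-elsewhere {v} {p} v≢e (inj₁ refl) =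
        return (inj₁ (cong (λ t → v , turn t p) (sym (agree v v≢e))))
      step-elsewhere v≢e (inj₂ refl) = return (inj₂ refl)

      -- Away from `e` a step is also a step of the cut surface, so gluing `x` to `y` only has to
      -- account for crossing `e`.
      step-merged : ∀ {x y} →
        (∀ p → Merged R x y (e , p) (e , turn (just (α e)) p)) →
        ∀ {u v} → Faces α u v → Merged R x y u v
      step-merged atCut ε = inj₁ ε
      step-merged atCut {v , p} (s ◅ path) =
        merged-trans equiv (first s) (step-merged atCut path)
        where
        first : ∀ {w} → Step (uncut α) τ (v , p) w → Merged R _ _ (v , p) w
        first s with v ≟ᶠ e
        first s           | no v≢e   = inj₁ (step-elsewhere v≢e s)
        first (inj₁ refl) | yes refl = atCut p
        first (inj₂ refl) | yes refl = inj₁ (return (inj₂ refl))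

      cutTransversal : ∀ {m} t → R (e , false , false) (e , true , t) →
        R (e , false , true) (e , true , not t) →
        ¬ R (e , false , false) (e , false , true) → Transversal R m →
        (α e ≡ t → Transversal (Faces α) m) ×
        (α e ≡ not t → ∃[ k ] m ≡ suc k × Transversal (Faces α) k)
      cutTransversal t p q apart T = same , merged
        where
        x = (e , false , false)
        -- The corner that twist `not t` joins to `x`; by `q` it lies on the other arc.
        y = (e , true , not t)

        same : α e ≡ t → Transversal (Faces α) _
        same refl = transport id id (λ _ → refl) cut⇒faces
          -- `x` is glued to itself here, so every case of `Merged` collapses to the cut relation.
          (λ path → [ id , [ (λ (r , r′) → R.trans r r′) , (λ (r , r′) → R.trans r r′) ]′ ]′
            (step-merged {x} {x} (inj₁ ∘ acrossCut) path)) T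
          where
          forwards : ∀ b → R (e , false , b) (e , true , b xor t)
          forwards false = p
          forwards true  = q
          acrossCut : ∀ z → R (e , z) (e , turn (just t) z)
          acrossCut (false , b) = forwards b
          acrossCut (true , b)  = R.sym (subst (λ c → R (e , false , b xor t) (e , true , c))
                                    (xor-xor b t) (forwards (b xor t)))

        merged : α e ≡ not t → ∃[ k ] _ ≡ suc k × Transversal (Faces α) k
        merged eq = mergeTransversal equiv _◅◅_ cut⇒faces
          -- Crossing `e` from `y` leads to the side `not t xor not t`, which is the side `false` of
          -- `x`.
          (return (inj₁ (cong (e ,_) (trans (cong (false ,_) (sym (xor-same (not t))))
                                            (cong (λ u → turn (just u) (true , not t)) (sym eq))))))
          (step-merged acrossCut) (λ x∼y → apart (R.trans x∼y (R.sym q))) T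
          where
          forwards : ∀ b → Merged R x y (e , false , b) (e , true , b xor not t)
          forwards false = inj₂ (inj₁ (R.refl , R.refl))
          forwards true  = inj₂ (inj₂ (q , subst (λ c → R x (e , true , c)) (sym (not-involutive t)) p))
          acrossCut : ∀ z → Merged R x y (e , z) (e , turn (just (α e)) z)
          acrossCut (false , b) = subst (λ u → Merged R x y (e , false , b) (e , true , b xor u))
                                        (sym eq) (forwards b)
          acrossCut (true , b)  = merged-sym equiv
            (subst₂ (λ u c → Merged R x y (e , false , b xor u) (e , true , c))
              (sym eq) (xor-xor b (not t)) (forwards (b xor not t)))

-- Parity of the number of faces under one half-twist

cutAt : ∀ {n} → Fin n → (Fin n → Bool) → Fin n → Maybe Bool
cutAt e α v = if does (v ≟ᶠ e) then nothing else just (α v)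

cutAt-here : ∀ {n} (e : Fin n) α → cutAt e α e ≡ nothing
cutAt-here e α = cong (λ d → if d then nothing else just (α e)) (dec-true (e ≟ᶠ e) refl)

cutAt-elsewhere : ∀ {n} (e : Fin n) α v → v ≢ e → cutAt e α v ≡ just (α v)
cutAt-elsewhere e α v v≢e = cong (λ d → if d then nothing else just (α v)) (dec-false (v ≟ᶠ e) v≢e)

orbitTransversal : ∀ {n} (ρ τ : Flag n → Flag n) →
  (∀ x → ρ (ρ x) ≡ x) → (∀ x → τ (τ x) ≡ x) → ∃ (Transversal (Orbit ρ τ))
orbitTransversal {n} ρ τ ρρ ττ = _ , deduplicateTransversal (orbit-isEquivalence ρ τ ρρ ττ)
  (Reachability.star? _≟ᶠˡ_ (flags n) ∈-flags
    λ x y → (y ≟ᶠˡ ρ x) ⊎-dec (y ≟ᶠˡ τ x))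
  (flags n) ∈-flags

-1^2+ : ∀ m → -1ℤ ^ suc (suc m) ≡ -1ℤ ^ m
-1^2+ m = trans (sym (ℤₚ.*-assoc -1ℤ -1ℤ (-1ℤ ^ m))) (ℤₚ.*-identityˡ _)

-- To be read with `a` boundaries when `e` is twisted, `b` when it is not, and `i` other
-- half-twists: the set loses one element while the boundary count changes by one either way.
-1^-parity : ∀ i {a b} → a ≡ suc b ⊎ b ≡ suc a → -1ℤ ^ (i + b) ≡ -1ℤ ^ suc (i + a)
-1^-parity i {b = b} (inj₁ refl) = sym (trans (cong (λ j → -1ℤ ^ suc j) (+-suc i b)) (-1^2+ (i + b)))
-1^-parity i {a}     (inj₂ refl) = cong (-1ℤ ^_) (+-suc i a)

module _ (G : EmbeddedGraph) (o : Flag (edges G) → Bool)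
         (oτ : ∀ x → o (τ₁ G x) ≢ o x) (oτ₀ : ∀ x → o (τ₀ x) ≢ o x)
         (oEnd : ∀ v a b b′ → o (v , a , b) ≡ o (v , a , b′)) where

  private
    n = edges G

  -- Both assignments become the same once `e` is cut, so both counts are compared with that of `U`.
  -- Exactly one of `α e` and `β e` is the `t` of `pairing`; its count is that of `U`, and the other
  -- is one less.
  flip-faces : ∀ (e : Fin n) (α β : Fin n → Bool) → (∀ v → v ≢ e → α v ≡ β v) → α e ≡ not (β e) →
               ∀ {a b} → Transversal (Faces G α) a → Transversal (Faces G β) b →
               a ≡ suc b ⊎ b ≡ suc a
  flip-faces e α β agree differ {a} {b} S T
    with t , p , q , apart ← pairing G o oτ oτ₀ oEnd e (cutAt e α) (cutAt-here e α)
           (λ v v≢e → α v , cutAt-elsewhere e α v v≢e)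
    = decide (β e ≟ᵇ t)
    where
    μ = cutAt e α
    isCut = cutAt-here e α
    elsewhere = λ v v≢e → α v , cutAt-elsewhere e α v v≢e
    U = proj₂ (orbitTransversal (across μ) (τ₁ G) (across-involutive μ) (τ₁-involutive G))
    cα = cutTransversal G o oτ oτ₀ oEnd e μ isCut elsewhere α (cutAt-elsewhere e α) t p q apart U
    cβ = cutTransversal G o oτ oτ₀ oEnd e μ isCut elsewhere β
           (λ v v≢e → trans (cutAt-elsewhere e α v v≢e) (cong just (agree v v≢e))) t p q apart U
    size : ∀ γ {j k} → Transversal (Faces G γ) j → Transversal (Faces G γ) k → j ≡ k
    size γ = transversal-size (faces-isEquivalence G γ)
    decide : _ → a ≡ suc b ⊎ b ≡ suc a
    decide (yes βe≡t) with k , eq , V ← proj₂ cα (trans differ (cong not βe≡t)) =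
      inj₂ (trans (size β T (proj₁ cβ βe≡t)) (trans eq (cong suc (size α V S))))
    decide (no βe≢t) with k , eq , V ← proj₂ cβ (¬-not βe≢t) =
      inj₁ (trans (size α S (proj₁ cα (trans differ (trans (cong not (¬-not βe≢t)) (not-involutive t)))))
                  (trans eq (cong suc (size β V T))))

  sign : Subset n → ℤ
  sign A = -1ℤ ^ (∣ A ∣ + boundaries G A)

  size-delete : ∀ {m} (A : Subset m) e → lookup A e ≡ inside → ∣ A ∣ ≡ suc ∣ A [ e ]≔ outside ∣
  size-delete (_ ∷ A)       zero    refl = refl
  size-delete (inside ∷ A)  (suc e) eq   = cong suc (size-delete A e eq)
  size-delete (outside ∷ A) (suc e) eq   = size-delete A e eq

  -- Deletion rather than toggling, so that repetition brings every `A` down to `⊥`; an `e` outside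
  -- `A` changes nothing.
  sign-delete : ∀ A e → sign (A [ e ]≔ outside) ≡ sign A
  sign-delete A e with lookup A e in eq
  ... | false = cong sign (trans (cong (A [ e ]≔_) (sym eq)) ([]≔-lookup A e))
  ... | true  = trans
    (-1^-parity ∣ A′ ∣ (flip-faces e (lookup A) (lookup A′)
      (λ v v≢e → sym (lookup∘update′ v≢e A outside))
      (trans eq (cong not (sym (lookup∘update e A outside))))
      (boundaryTransversal G A) (boundaryTransversal G A′)))
    (cong (λ i → -1ℤ ^ (i + boundaries G A)) (sym (size-delete A e eq)))
    where A′ = A [ e ]≔ outside

delete-invariant : ∀ {B : Set} {n} (g : Subset n → B) →
                   (∀ A e → g (A [ e ]≔ outside) ≡ g A) → ∀ A → g A ≡ g ⊥
delete-invariant g inv []      = refl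
delete-invariant g inv (s ∷ A) = trans (sym (inv (s ∷ A) zero))
  (delete-invariant (g ∘ (outside ∷_)) (λ A e → inv (outside ∷ A) (suc e)) A)

-- The orientation of the Petrie dual of the dual, read on the flags of G

module _ (G : EmbeddedGraph) where

  private
    G⊥ = partialPetrial G ⊥

    h : Flag (edges G) → Flag (edges G)
    h = halfTwist ⊥

    h-id : ∀ x → h x ≡ x
    h-id (e , a , b) = cong (λ c → e , a , c) (lemma a b (lookup-replicate e outside))
      where
      lemma : ∀ a b {t} → t ≡ false → b xor (a ∧ t) ≡ b
      lemma false false refl = refl
      lemma false true  refl = refl
      lemma true  false refl = refl
      lemma true  true  refl = refl

    τ-id : ∀ x → τ₁ G⊥ x ≡ τ₁ G x
    τ-id x = trans (h-id _) (cong (τ₁ G) (h-id x))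

  -- `τ₁ G⊥` and `τ₁ G` agree only pointwise, so the faces are matched through transversals.
  f-⊥ : f G⊥ ≡ f G
  f-⊥ = cong (_+ isolated G) (transversal-size
    (orbit-isEquivalence τ₀ (τ₁ G) τ₀-involutive (τ₁-involutive G))
    (transport id id (λ _ → refl)
      (gmap id λ where (inj₁ p) → inj₁ p
                       (inj₂ p) → inj₂ (trans p (τ-id _)))
      (gmap id λ where (inj₁ p) → inj₁ p
                       (inj₂ p) → inj₂ (trans p (sym (τ-id _))))
      (deduplicateTransversal
        (orbit-isEquivalence τ₀ (τ₁ G⊥) τ₀-involutive (τ₁-involutive G⊥))
        (sameFace? G⊥) _ ∈-flags))
    (deduplicateTransversal
      (orbit-isEquivalence τ₀ (τ₁ G) τ₀-involutive (τ₁-involutive G))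
      (sameFace? G) _ ∈-flags))

  module _ (orientable : Orientable (petrial (dual G))) where

    private
      o′ = proj₁ orientable
      -- The position in G^{*×} of the corner x of G.
      corner : Flag (edges G) → Flag (edges G)
      corner = halfTwist ⊤ ∘ swapEndSide

      o : Flag (edges G) → Bool
      o = o′ ∘ corner

      corner≡ : ∀ e a b → corner (e , a , b) ≡ (e , b , a xor b)
      corner≡ e a b = cong (λ t → e , b , a xor t)
        (trans (cong (b ∧_) (lookup-replicate e inside)) (∧-identityʳ b))

      oτ : ∀ x → o (τ₁ G x) ≢ o x
      oτ x = subst (λ y → o′ (corner (τ₁ G y)) ≢ o x)
        (cong swapEndSide (halfTwist-involutive ⊤ (swapEndSide x)))
        (proj₁ (proj₂ (proj₂ orientable (corner x))))

      oτ₂′ : ∀ e a b → o′ (e , a , not b) ≢ o′ (e , a , b)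
      oτ₂′ e a b = proj₂ (proj₂ (proj₂ orientable (e , a , b)))

      oτ₀′ : ∀ e a b → o′ (e , not a , b) ≢ o′ (e , a , b)
      oτ₀′ e a b = proj₁ (proj₂ orientable (e , a , b))

      -- Changing `a` in `(e , b , a xor b)` alters only the last entry, so `τ₀` of G acts as `τ₂`
      -- of the new graph.
      oτ₀ : ∀ x → o (τ₀ x) ≢ o x
      oτ₀ (e , a , b) eq = oτ₂′ e b (a xor b) (begin
        o′ (e , b , not (a xor b)) ≡⟨ cong (λ c → o′ (e , b , c)) (not-distribˡ-xor a b) ⟩
        o′ (e , b , not a xor b)   ≡⟨ cong o′ (corner≡ e (not a) b) ⟨
        o (e , not a , b)          ≡⟨ eq ⟩
        o (e , a , b)              ≡⟨ cong o′ (corner≡ e a b) ⟩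
        o′ (e , b , a xor b)       ∎)
        where open ≡-Reasoning

      -- Changing `b` in `(e , b , a xor b)` alters both entries. That is one `τ₀` and one `τ₂` of
      -- the new graph, and their two reversals of `o′` cancel.
      oSide : ∀ e a → o (e , a , true) ≡ o (e , a , false)
      oSide e a = begin
        o (e , a , true)                   ≡⟨ cong o′ (corner≡ e a true) ⟩
        o′ (e , true , a xor true)         ≡⟨ ¬-not (oτ₀′ e false _) ⟩
        not (o′ (e , false , a xor true))  ≡⟨ cong (λ c → not (o′ (e , false , c))) (not-distribʳ-xor a false) ⟨
        not (o′ (e , false , not (a xor false))) ≡⟨ cong not (¬-not (oτ₂′ e false _)) ⟩
        not (not (o′ (e , false , a xor false))) ≡⟨ not-involutive _ ⟩
        o′ (e , false , a xor false)       ≡⟨ cong o′ (corner≡ e a false) ⟨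
        o (e , a , false)                  ∎
        where open ≡-Reasoning

      oEnd : ∀ e a b b′ → o (e , a , b) ≡ o (e , a , b′)
      oEnd e a false false = refl
      oEnd e a false true  = sym (oSide e a)
      oEnd e a true  false = oSide e a
      oEnd e a true  true  = refl

    face-parity : ∀ A → -1ℤ ^ (∣ A ∣ + f (partialPetrial G A)) ≡ -1ℤ ^ f G
    face-parity A = begin
      -1ℤ ^ (∣ A ∣ + f (partialPetrial G A)) ≡⟨ split A ⟩
      sign G o oτ oτ₀ oEnd A * -1ℤ ^ isolated G
        ≡⟨ cong (_* -1ℤ ^ isolated G)
             (delete-invariant (sign G o oτ oτ₀ oEnd) (sign-delete G o oτ oτ₀ oEnd) A) ⟩
      sign G o oτ oτ₀ oEnd ⊥ * -1ℤ ^ isolated G ≡⟨ split ⊥ ⟨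
      -1ℤ ^ (∣ ⊥ {edges G} ∣ + f G⊥)  ≡⟨ cong₂ (λ i j → -1ℤ ^ (i + j)) (∣⊥∣≡0 (edges G)) f-⊥ ⟩
      -1ℤ ^ f G ∎
      where
      open ≡-Reasoning
      split : ∀ A → -1ℤ ^ (∣ A ∣ + f (partialPetrial G A)) ≡
                    sign G o oτ oτ₀ oEnd A * -1ℤ ^ isolated G
      split A = trans (cong (-1ℤ ^_) (sym (ℕₚ.+-assoc ∣ A ∣ (boundaries G A) (isolated G))))
                      (ℤₚ.^-distribˡ-+-* -1ℤ (∣ A ∣ + boundaries G A) (isolated G))

-- Counting by sums of indicators

⟦_⟧ : {A : Set} → Dec A → ℕ
⟦ a? ⟧ = if does a? then 1 else 0

⟦⟧-yes : {A : Set} (a? : Dec A) → A → ⟦ a? ⟧ ≡ 1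
⟦⟧-yes (yes _) a = refl
⟦⟧-yes (no ¬a) a = contradiction a ¬a

⟦⟧-no : {A : Set} (a? : Dec A) → ¬ A → ⟦ a? ⟧ ≡ 0
⟦⟧-no (yes a) ¬a = contradiction a ¬a
⟦⟧-no (no _)  ¬a = refl

⟦⟧-cong : {A B : Set} (a? : Dec A) (b? : Dec B) → (A → B) → (B → A) → ⟦ a? ⟧ ≡ ⟦ b? ⟧
⟦⟧-cong (yes a) b? to from = sym (⟦⟧-yes b? (to a))
⟦⟧-cong (no ¬a) b? to from = sym (⟦⟧-no b? (¬a ∘ from))

⟦⟧-× : {A B : Set} (a? : Dec A) (b? : Dec B) → ⟦ a? ×-dec b? ⟧ ≡ ⟦ a? ⟧ *ℕ ⟦ b? ⟧
⟦⟧-× (yes _) b? = sym (ℕₚ.*-identityˡ _)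
⟦⟧-× (no _)  b? = refl

⟦⟧-all? : ∀ {n} {P : Fin (suc n) → Set} (P? : Decidable₁ P) →
          ⟦ all? P? ⟧ ≡ ⟦ P? zero ⟧ *ℕ ⟦ all? (P? ∘ suc) ⟧
⟦⟧-all? P? = trans
  (⟦⟧-cong (all? P?) (P? zero ×-dec all? (P? ∘ suc)) (λ p → p zero , p ∘ suc)
    λ (p , ps) → λ where zero → p
                         (suc i) → ps i)
  (⟦⟧-× (P? zero) (all? (P? ∘ suc)))

∑ : {A : Set} → List A → (A → ℕ) → ℕ
∑ xs g = sum (map g xs)

module _ {A : Set} where

  ∑-cong : ∀ (xs : List A) {g h} → (∀ x → g x ≡ h x) → ∑ xs g ≡ ∑ xs h
  ∑-cong xs g≗h = cong sum (map-cong g≗h xs)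

  ∑-* : ∀ (xs : List A) c g → ∑ xs (λ x → c *ℕ g x) ≡ c *ℕ ∑ xs g
  ∑-* []       c g = sym (ℕₚ.*-zeroʳ c)
  ∑-* (x ∷ xs) c g = trans (cong₂ _+_ refl (∑-* xs c g)) (sym (ℕₚ.*-distribˡ-+ c _ _))

  ∑-zero : ∀ (xs : List A) → ∑ xs (λ _ → 0) ≡ 0
  ∑-zero []       = refl
  ∑-zero (x ∷ xs) = ∑-zero xs

  ∑-+ : ∀ (xs : List A) g h → ∑ xs (λ x → g x + h x) ≡ ∑ xs g + ∑ xs h
  ∑-+ []       g h = refl
  ∑-+ (x ∷ xs) g h = trans (cong₂ _+_ refl (∑-+ xs g h)) (interchange (g x) (h x) (∑ xs g) (∑ xs h))
    where
    interchange : ∀ a b c d → (a + b) + (c + d) ≡ (a + c) + (b + d)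
    interchange = solve-∀

  ∑-filter : ∀ {P : A → Set} (P? : Decidable₁ P) (g : A → ℕ) xs →
             ∑ (filter P? xs) g ≡ ∑ xs (λ x → ⟦ P? x ⟧ *ℕ g x)
  ∑-filter P? g []       = refl
  ∑-filter P? g (x ∷ xs) with P? x
  ... | yes _ = cong₂ _+_ (sym (ℕₚ.*-identityˡ (g x))) (∑-filter P? g xs)
  ... | no _  = ∑-filter P? g xs

  length-filter : ∀ {P : A → Set} (P? : Decidable₁ P) xs →
                  length (filter P? xs) ≡ ∑ xs (λ x → ⟦ P? x ⟧)
  length-filter P? []       = refl
  length-filter P? (x ∷ xs) with P? x
  ... | yes _ = cong suc (length-filter P? xs)
  ... | no _  = length-filter P? xs

∑-swap : ∀ {A B : Set} (xs : List A) (ys : List B) (g : A → B → ℕ) →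
         ∑ xs (λ x → ∑ ys (g x)) ≡ ∑ ys (λ y → ∑ xs (λ x → g x y))
∑-swap []       ys g = sym (∑-zero ys)
∑-swap (x ∷ xs) ys g = trans (cong₂ _+_ refl (∑-swap xs ys g)) (sym (∑-+ ys (g x) _))

length-cartesianProductWith : ∀ {A B C : Set} (g : A → B → C) xs ys →
  length (cartesianProductWith g xs ys) ≡ length xs *ℕ length ys
length-cartesianProductWith g []       ys = refl
length-cartesianProductWith g (x ∷ xs) ys = trans (length-++ (map (g x) ys))
  (cong₂ _+_ (length-map (g x) ys) (length-cartesianProductWith g xs ys))

module _ {A : Set} (xs : List A) where

  length-allVecs : ∀ n → length (allVecs xs n) ≡ length xs ^ℕ n
  length-allVecs zero    = refl
  length-allVecs (suc n) = trans (length-cartesianProductWith _∷_ xs (allVecs xs n))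
                                 (cong (length xs *ℕ_) (length-allVecs n))

  ∈-allVecs : (∀ x → x ∈ xs) → ∀ {n} (v : Vec A n) → v ∈ allVecs xs n
  ∈-allVecs complete []      = here refl
  ∈-allVecs complete (x ∷ v) = ∈-cartesianProductWith⁺ _∷_ (complete x) (∈-allVecs complete v)

  allVecs-unique : Unique xs → ∀ n → Unique (allVecs xs n)
  allVecs-unique xs! zero    = [] ∷ []
  allVecs-unique xs! (suc n) =
    Uniqueₚ.cartesianProductWith⁺ _∷_ ∷-injective xs! (allVecs-unique xs! n)

∑-allSubsets-suc : ∀ n (g : Subset (suc n) → ℕ) →
  ∑ (allSubsets (suc n)) g ≡
  ∑ (allSubsets n) (g ∘ (outside ∷_)) + ∑ (allSubsets n) (g ∘ (inside ∷_))
∑-allSubsets-suc n g = begin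
  sum (map g (map (outside ∷_) As ++ (map (inside ∷_) As ++ [])))
    ≡⟨ cong sum (map-++ g (map (outside ∷_) As) _) ⟩
  sum (map g (map (outside ∷_) As) ++ map g (map (inside ∷_) As ++ []))
    ≡⟨ sum-++ (map g (map (outside ∷_) As)) _ ⟩
  sum (map g (map (outside ∷_) As)) + sum (map g (map (inside ∷_) As ++ []))
    ≡⟨ cong₂ _+_ (cong sum (sym (map-∘ As)))
         (cong (sum ∘ map g) (++-identityʳ (map (inside ∷_) As))) ⟩
  ∑ As (g ∘ (outside ∷_)) + sum (map g (map (inside ∷_) As))
    ≡⟨ cong₂ _+_ refl (cong sum (sym (map-∘ As))) ⟩
  ∑ As (g ∘ (outside ∷_)) + ∑ As (g ∘ (inside ∷_)) ∎
  where
  open ≡-Reasoning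
  As = allSubsets n

-- Colours at a vertex

module _ {k : ℕ} where

  -- The colours are constant on the two strands through a ribbon with this twist: its sides if
  -- untwisted, the diagonals if twisted. Unlike `White` and `Crossing`, the two strands may share a
  -- colour, so a total vertex fits both choices.
  Fits : Bool → Vec (Fin k) 4 → Set
  Fits false (h₁ ∷ h₂ ∷ h₃ ∷ h₄ ∷ []) = h₁ ≡ h₂ × h₃ ≡ h₄
  Fits true  (h₁ ∷ h₂ ∷ h₃ ∷ h₄ ∷ []) = h₁ ≡ h₃ × h₂ ≡ h₄

  fits? : ∀ t → Decidable₁ (Fits t)
  fits? false (h₁ ∷ h₂ ∷ h₃ ∷ h₄ ∷ []) = (h₁ ≟ᶠ h₂) ×-dec (h₃ ≟ᶠ h₄)
  fits? true  (h₁ ∷ h₂ ∷ h₃ ∷ h₄ ∷ []) = (h₁ ≟ᶠ h₃) ×-dec (h₂ ≟ᶠ h₄)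

  Permitted : Vec (Fin k) 4 → Set
  Permitted hs = White hs ⊎ Crossing hs ⊎ Total hs

  permitted? : Decidable₁ Permitted
  permitted? hs = white? hs ⊎-dec crossing? hs ⊎-dec total? hs

  permitted⇒fits : ∀ hs → Permitted hs → Fits false hs ⊎ Fits true hs
  permitted⇒fits (_ ∷ _ ∷ _ ∷ _ ∷ []) (inj₁ (p , q , _))             = inj₁ (p , q)
  permitted⇒fits (_ ∷ _ ∷ _ ∷ _ ∷ []) (inj₂ (inj₁ (p , q , _)))      = inj₂ (p , q)
  permitted⇒fits (_ ∷ _ ∷ _ ∷ _ ∷ []) (inj₂ (inj₂ (refl , _ , p)))   = inj₁ (refl , p)

  total⇒fits : ∀ t hs → Total hs → Fits t hs
  total⇒fits false (_ ∷ _ ∷ _ ∷ _ ∷ []) (refl , refl , refl) = refl , refl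
  total⇒fits true  (_ ∷ _ ∷ _ ∷ _ ∷ []) (refl , refl , refl) = refl , refl

  fits-both⇒total : ∀ hs → Fits false hs → Fits true hs → Total hs
  fits-both⇒total (_ ∷ _ ∷ _ ∷ _ ∷ []) (refl , refl) (refl , _) = refl , refl , refl

  fits⇒permitted : ∀ t hs → ¬ Total hs → Fits t hs → Permitted hs
  fits⇒permitted false (_ ∷ _ ∷ _ ∷ _ ∷ []) ¬t (refl , refl) =
    inj₁ (refl , refl , λ where refl → ¬t (refl , refl , refl))
  fits⇒permitted true  (_ ∷ _ ∷ _ ∷ _ ∷ []) ¬t (refl , refl) =
    inj₂ (inj₁ (refl , refl , λ where refl → ¬t (refl , refl , refl)))

  fits-even : ∀ t hs → Fits t hs → ∀ c → 2 ∣ Vec.count (_≟ᶠ c) hs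
  fits-even false (a ∷ _ ∷ b ∷ _ ∷ []) (refl , refl) c with a ≟ᶠ c | b ≟ᶠ c
  ... | yes _ | yes _ = divides 2 refl
  ... | yes _ | no _  = divides 1 refl
  ... | no _  | yes _ = divides 1 refl
  ... | no _  | no _  = divides 0 refl
  fits-even true (a ∷ b ∷ _ ∷ _ ∷ []) (refl , refl) c with a ≟ᶠ c | b ≟ᶠ c
  ... | yes _ | yes _ = divides 2 refl
  ... | yes _ | no _  = divides 1 refl
  ... | no _  | yes _ = divides 1 refl
  ... | no _  | no _  = divides 0 refl

  permitted-even : ∀ hs → Permitted hs → ∀ c → 2 ∣ Vec.count (_≟ᶠ c) hs
  permitted-even hs p with permitted⇒fits hs p
  ... | inj₁ q = fits-even false hs q
  ... | inj₂ q = fits-even true hs q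

  -- The source of the factor 2: a total vertex fits both twists, a white or crossing one fits
  -- exactly one, and any other fits none.
  local-count : ∀ hs → ⟦ fits? false hs ⟧ + ⟦ fits? true hs ⟧ ≡
                       ⟦ permitted? hs ⟧ *ℕ 2 ^ℕ ⟦ total? hs ⟧
  local-count hs = go (total? hs) (fits? false hs) (fits? true hs)
    where
    go : (t? : Dec (Total hs)) (f? : Dec (Fits false hs)) (g? : Dec (Fits true hs)) →
         ⟦ f? ⟧ + ⟦ g? ⟧ ≡ ⟦ permitted? hs ⟧ *ℕ 2 ^ℕ ⟦ t? ⟧
    go (yes t) f? g? rewrite ⟦⟧-yes f? (total⇒fits false hs t) | ⟦⟧-yes g? (total⇒fits true hs t)
                           | ⟦⟧-yes (permitted? hs) (inj₂ (inj₂ t)) = refl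
    go (no ¬t) (yes f) (yes g) = contradiction (fits-both⇒total hs f g) ¬t
    go (no ¬t) (yes f) (no _)  rewrite ⟦⟧-yes (permitted? hs) (fits⇒permitted false hs ¬t f) = refl
    go (no ¬t) (no _)  (yes g) rewrite ⟦⟧-yes (permitted? hs) (fits⇒permitted true hs ¬t g) = refl
    go (no ¬t) (no ¬f) (no ¬g) rewrite ⟦⟧-no (permitted? hs) ([ ¬f , ¬g ]′ ∘ permitted⇒fits hs) = refl

  2^count-total : ∀ {n} hs (hss : Vec (Vec (Fin k) 4) n) →
    2 ^ℕ Vec.count total? (hs ∷ hss) ≡ 2 ^ℕ ⟦ total? hs ⟧ *ℕ 2 ^ℕ Vec.count total? hss
  2^count-total hs hss with total? hs
  ... | yes _ = refl
  ... | no _  = sym (ℕₚ.*-identityˡ _)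

  FitsAll : ∀ {n} → Subset n → Vec (Vec (Fin k) 4) n → Set
  FitsAll A hss = ∀ v → Fits (lookup A v) (lookup hss v)

  fitsAll? : ∀ {n} (A : Subset n) → Decidable₁ (FitsAll A)
  fitsAll? A hss = all? λ v → fits? (lookup A v) (lookup hss v)

  -- Twists at different vertices are chosen independently, so the sum over subsets factors into the
  -- local counts.
  count-fitting : ∀ {n} (hss : Vec (Vec (Fin k) 4) n) →
    ∑ (allSubsets n) (λ A → ⟦ fitsAll? A hss ⟧) ≡
    ⟦ all? (λ v → permitted? (lookup hss v)) ⟧ *ℕ 2 ^ℕ Vec.count total? hss
  count-fitting []         = refl
  count-fitting {suc n} (hs ∷ hss) = begin
    ∑ (allSubsets (suc n)) (λ A → ⟦ fitsAll? A (hs ∷ hss) ⟧) ≡⟨ ∑-allSubsets-suc n _ ⟩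
    side false + side true ≡⟨ cong₂ _+_ (side≡ false) (side≡ true) ⟩
    ⟦ fits? false hs ⟧ *ℕ rest + ⟦ fits? true hs ⟧ *ℕ rest
      ≡⟨ ℕₚ.*-distribʳ-+ rest ⟦ fits? false hs ⟧ ⟦ fits? true hs ⟧ ⟨
    (⟦ fits? false hs ⟧ + ⟦ fits? true hs ⟧) *ℕ rest
      ≡⟨ cong₂ _*ℕ_ (local-count hs) (count-fitting hss) ⟩
    (⟦ permitted? hs ⟧ *ℕ 2 ^ℕ ⟦ total? hs ⟧) *ℕ (restPermitted *ℕ 2 ^ℕ Vec.count total? hss)
      ≡⟨ interchange ⟦ permitted? hs ⟧ (2 ^ℕ ⟦ total? hs ⟧) restPermitted (2 ^ℕ Vec.count total? hss) ⟩
    (⟦ permitted? hs ⟧ *ℕ restPermitted) *ℕ (2 ^ℕ ⟦ total? hs ⟧ *ℕ 2 ^ℕ Vec.count total? hss)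
      ≡⟨ cong₂ _*ℕ_ (⟦⟧-all? (λ v → permitted? (lookup (hs ∷ hss) v))) (2^count-total hs hss) ⟨
    ⟦ all? (λ v → permitted? (lookup (hs ∷ hss) v)) ⟧ *ℕ 2 ^ℕ Vec.count total? (hs ∷ hss) ∎
    where
    open ≡-Reasoning
    side : Bool → ℕ
    side t = ∑ (allSubsets n) (λ A → ⟦ fitsAll? (t ∷ A) (hs ∷ hss) ⟧)
    rest restPermitted : ℕ
    rest = ∑ (allSubsets n) (λ A → ⟦ fitsAll? A hss ⟧)
    restPermitted = ⟦ all? (λ v → permitted? (lookup hss v)) ⟧
    side≡ : ∀ t → side t ≡ ⟦ fits? t hs ⟧ *ℕ rest
    side≡ t = trans
      (∑-cong (allSubsets n) λ A → ⟦⟧-all? (λ v → fits? (lookup (t ∷ A) v) (lookup (hs ∷ hss) v)))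
      (∑-* (allSubsets n) ⟦ fits? t hs ⟧ (λ A → ⟦ fitsAll? A hss ⟧))
    interchange : ∀ a b c d → (a *ℕ b) *ℕ (c *ℕ d) ≡ (a *ℕ c) *ℕ (b *ℕ d)
    interchange = solve-∀

-- Colourings that are constant along the faces of a partial Petrial

side : Bool × Bool → Fin 4
side (false , false) = 0F
side (true  , false) = 1F
side (true  , true ) = 2F
side (false , true ) = 3F

toHalf≡ : ∀ {n} (v : Fin n) p → toHalf (v , p) ≡ (v , side p)
toHalf≡ v (false , false) = refl
toHalf≡ v (true  , false) = refl
toHalf≡ v (true  , true ) = refl
toHalf≡ v (false , true ) = refl

fits⇒constant : ∀ {k} t (hs : Vec (Fin k) 4) → Fits t hs →
                ∀ p → lookup hs (side (turn (just t) p)) ≡ lookup hs (side p)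
fits⇒constant false (_ ∷ _ ∷ _ ∷ _ ∷ []) (p , q) (false , false) = sym p
fits⇒constant false (_ ∷ _ ∷ _ ∷ _ ∷ []) (p , q) (true  , false) = p
fits⇒constant false (_ ∷ _ ∷ _ ∷ _ ∷ []) (p , q) (true  , true ) = sym q
fits⇒constant false (_ ∷ _ ∷ _ ∷ _ ∷ []) (p , q) (false , true ) = q
fits⇒constant true  (_ ∷ _ ∷ _ ∷ _ ∷ []) (p , q) (false , false) = sym p
fits⇒constant true  (_ ∷ _ ∷ _ ∷ _ ∷ []) (p , q) (true  , false) = sym q
fits⇒constant true  (_ ∷ _ ∷ _ ∷ _ ∷ []) (p , q) (true  , true ) = p
fits⇒constant true  (_ ∷ _ ∷ _ ∷ _ ∷ []) (p , q) (false , true ) = q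

constant⇒fits : ∀ {k} t (hs : Vec (Fin k) 4) →
                (∀ p → lookup hs (side (turn (just t) p)) ≡ lookup hs (side p)) → Fits t hs
constant⇒fits false (_ ∷ _ ∷ _ ∷ _ ∷ []) c = c (true , false) , c (false , true)
constant⇒fits true  (_ ∷ _ ∷ _ ∷ _ ∷ []) c = c (true , true) , c (false , true)

lookup-ext : ∀ {A : Set} {n} {u v : Vec A n} → (∀ i → lookup u i ≡ lookup v i) → u ≡ v
lookup-ext {u = u} {v} eq =
  trans (sym (tabulate∘lookup u)) (trans (tabulate-cong eq) (tabulate∘lookup v))

module _ (G : EmbeddedGraph) (k : ℕ) where

  private
    n = edges G
    M = medial G

  EdgeColouring : Colouring M k → Set
  EdgeColouring φ = ∀ v i → colour M k φ (partner M (v , i)) ≡ colour M k φ (v , i)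

  edgeColouring? : Decidable₁ EdgeColouring
  edgeColouring? φ = all? λ v → all? λ i →
    colour M k φ (partner M (v , i)) ≟ᶠ colour M k φ (v , i)

  -- These are the colourings that descend to the boundary components of the partial Petrial; the
  -- free loops keep arbitrary colours and stand for the isolated vertices counted by `f`.
  FaceColouring : Subset n → Colouring M k → Set
  FaceColouring A φ = EdgeColouring φ × FitsAll A (proj₁ φ)

  faceColouring? : ∀ A → Decidable₁ (FaceColouring A)
  faceColouring? A φ = edgeColouring? φ ×-dec fitsAll? A (proj₁ φ)

  flagColour : Colouring M k → Flag n → Fin k
  flagColour φ x = colour M k φ (toHalf x)

  colour-side : ∀ φ v p → flagColour φ (v , p) ≡ lookup (lookup (proj₁ φ) v) (side p)
  colour-side φ v p = cong (colour M k φ) (toHalf≡ v p)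

  faceColouring⇒constant : ∀ {A φ} → FaceColouring A φ → ∀ {x y} →
    Faces G (lookup A) x y → flagColour φ x ≡ flagColour φ y
  faceColouring⇒constant fc ε = refl
  faceColouring⇒constant {A} {φ} fc@(_ , fits) {v , p} {y} (inj₁ refl ◅ path) = begin
    flagColour φ (v , p)                                ≡⟨ colour-side φ v p ⟩
    lookup (lookup (proj₁ φ) v) (side p)                ≡⟨ fits⇒constant (lookup A v) _ (fits v) p ⟨
    lookup (lookup (proj₁ φ) v) (side (turn (just (lookup A v)) p)) ≡⟨ colour-side φ v _ ⟨
    flagColour φ (uncut (lookup A) (v , p))             ≡⟨ faceColouring⇒constant {A} {φ} fc path ⟩
    flagColour φ y                                      ∎
    where open ≡-Reasoning
  faceColouring⇒constant {A} {φ} fc@(edge , _) {x} {y} (inj₂ refl ◅ path) = begin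
    flagColour φ x            ≡⟨ uncurry edge (toHalf x) ⟨
    colour M k φ (partner M (toHalf x)) ≡⟨ cong (flagColour φ ∘ τ₁ G) (fromHalf-toHalf x) ⟩
    flagColour φ (τ₁ G x)     ≡⟨ faceColouring⇒constant {A} {φ} fc path ⟩
    flagColour φ y            ∎
    where open ≡-Reasoning

  constant⇒faceColouring : ∀ {A φ} →
    (∀ {x y} → Faces G (lookup A) x y → flagColour φ x ≡ flagColour φ y) → FaceColouring A φ
  constant⇒faceColouring {A} {φ} const =
    (λ v i → begin
      flagColour φ (τ₁ G (fromHalf (v , i))) ≡⟨ const {fromHalf (v , i)} (return (inj₂ refl)) ⟨
      flagColour φ (fromHalf (v , i))        ≡⟨ cong (colour M k φ) (toHalf-fromHalf (v , i)) ⟩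
      colour M k φ (v , i)                   ∎) ,
    (λ v → constant⇒fits (lookup A v) _ λ p → begin
      lookup (lookup (proj₁ φ) v) (side (turn (just (lookup A v)) p)) ≡⟨ colour-side φ v _ ⟨
      flagColour φ (uncut (lookup A) (v , p)) ≡⟨ const {v , p} (return (inj₁ refl)) ⟨
      flagColour φ (v , p)                   ≡⟨ colour-side φ v p ⟩
      lookup (lookup (proj₁ φ) v) (side p)   ∎)
    where open ≡-Reasoning

  ∈-allColourings : ∀ φ → φ ∈ allColourings M k
  ∈-allColourings φ = ∈-cartesianProduct⁺
    (∈-allVecs _ (∈-allVecs _ ∈-allFin) (proj₁ φ)) (∈-allVecs _ ∈-allFin (proj₂ φ))

  allColourings-unique : Unique (allColourings M k)
  allColourings-unique = Uniqueₚ.cartesianProduct⁺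
    (allVecs-unique _ (allVecs-unique _ (allFin⁺ k) 4) n) (allVecs-unique _ (allFin⁺ k) (isolated G))

  module _ (A : Subset n) where

    private
      E = faces-isEquivalence G (lookup A)
      T = boundaryTransversal G A
      m = boundaries G A
      D = Vec (Fin k) m × Vec (Fin k) (isolated G)
      Ds = cartesianProduct (allVecs (List.allFin k) m) (allVecs (List.allFin k) (isolated G))

    paint : D → Colouring M k
    paint (ψ , loops) =
      tabulate (λ v → tabulate λ i → lookup ψ (index T (fromHalf (v , i)))) , loops

    colour-paint : ∀ d h → colour M k (paint d) h ≡ lookup (proj₁ d) (index T (fromHalf h))
    colour-paint d (v , i) = trans
      (cong (λ hs → lookup hs i) (lookup∘tabulate (λ w → tabulate (c w)) v))
      (lookup∘tabulate (c v) i)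
      where c = λ w j → lookup (proj₁ d) (index T (fromHalf (w , j)))

    flagColour-paint : ∀ d x → flagColour (paint d) x ≡ lookup (proj₁ d) (index T x)
    flagColour-paint d x = trans (colour-paint d (toHalf x))
                                 (cong (lookup (proj₁ d) ∘ index T) (fromHalf-toHalf x))

    paint-faceColouring : ∀ d → FaceColouring A (paint d)
    paint-faceColouring d = constant⇒faceColouring {A} {paint d} λ {x} {y} path → begin
      flagColour (paint d) x       ≡⟨ flagColour-paint d x ⟩
      lookup (proj₁ d) (index T x) ≡⟨ cong (lookup (proj₁ d)) (index-cong E T path) ⟩
      lookup (proj₁ d) (index T y) ≡⟨ flagColour-paint d y ⟨
      flagColour (paint d) y       ∎
      where open ≡-Reasoning

    paint-injective : ∀ {d d′} → paint d ≡ paint d′ → d ≡ d′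
    paint-injective {d} {d′} eq = cong₂ _,_ (lookup-ext λ i → begin
        lookup (proj₁ d) i                   ≡⟨ cong (lookup (proj₁ d)) (index-rep E T i) ⟨
        lookup (proj₁ d) (index T (rep T i)) ≡⟨ flagColour-paint d (rep T i) ⟨
        flagColour (paint d) (rep T i)       ≡⟨ cong (λ φ → flagColour φ (rep T i)) eq ⟩
        flagColour (paint d′) (rep T i)      ≡⟨ flagColour-paint d′ (rep T i) ⟩
        lookup (proj₁ d′) (index T (rep T i)) ≡⟨ cong (lookup (proj₁ d′)) (index-rep E T i) ⟩
        lookup (proj₁ d′) i                  ∎)
      (cong proj₂ eq)
      where open ≡-Reasoning

    sample : Colouring M k → D
    sample φ = tabulate (flagColour φ ∘ rep T) , proj₂ φ

    paint-sample : ∀ φ → FaceColouring A φ → paint (sample φ) ≡ φ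
    paint-sample φ fc = cong (_, proj₂ φ) (lookup-ext {u = proj₁ (paint (sample φ))} λ v → lookup-ext λ i → begin
        colour M k (paint (sample φ)) (v , i)   ≡⟨ colour-paint (sample φ) (v , i) ⟩
        lookup (proj₁ (sample φ)) (index T (fromHalf (v , i))) ≡⟨ lookup∘tabulate (flagColour φ ∘ rep T) _ ⟩
        flagColour φ (rep T (index T (fromHalf (v , i))))
          ≡⟨ faceColouring⇒constant {A} {φ} fc (∼-index T (fromHalf (v , i))) ⟨
        flagColour φ (fromHalf (v , i))         ≡⟨ cong (colour M k φ) (toHalf-fromHalf (v , i)) ⟩
        colour M k φ (v , i)                    ∎)
      where open ≡-Reasoning

    -- `paint` is a bijection from the colourings of the faces and loops, with inverse `sample`.
    -- Both lists are free of repetitions and have the same members, hence the same length.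
    count-faceColourings : ∑ (allColourings M k) (λ φ → ⟦ faceColouring? A φ ⟧) ≡
                           k ^ℕ f (partialPetrial G A)
    count-faceColourings = begin
      ∑ (allColourings M k) (λ φ → ⟦ faceColouring? A φ ⟧)
        ≡⟨ length-filter (faceColouring? A) (allColourings M k) ⟨
      length (filter (faceColouring? A) (allColourings M k))
        ≡⟨ ↭-length (∼bag⇒↭ (unique∧set⇒bag
        (Uniqueₚ.filter⁺ (faceColouring? A) allColourings-unique)
        (Uniqueₚ.map⁺ paint-injective (Uniqueₚ.cartesianProduct⁺
          (allVecs-unique _ (allFin⁺ k) m) (allVecs-unique _ (allFin⁺ k) (isolated G))))
        (mk⇔ to from))) ⟩
      length (map paint Ds) ≡⟨ length-map paint Ds ⟩
      length Ds
        ≡⟨ length-cartesianProductWith _,_ (allVecs (List.allFin k) m) (allVecs (List.allFin k) (isolated G)) ⟩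
      length (allVecs (List.allFin k) m) *ℕ length (allVecs (List.allFin k) (isolated G))
        ≡⟨ cong₂ _*ℕ_ (size m) (size (isolated G)) ⟩
      k ^ℕ m *ℕ k ^ℕ isolated G ≡⟨ ℕₚ.^-distribˡ-+-* k m (isolated G) ⟨
      k ^ℕ f (partialPetrial G A) ∎
      where
      open ≡-Reasoning
      size : ∀ j → length (allVecs (List.allFin k) j) ≡ k ^ℕ j
      size j = trans (length-allVecs (List.allFin k) j) (cong (_^ℕ j) (length-tabulate id))
      to : ∀ {φ} → φ ∈ filter (faceColouring? A) (allColourings M k) → φ ∈ map paint Ds
      to {φ} φ∈ = subst (_∈ map paint Ds)
        (paint-sample φ (proj₂ (∈-filter⁻ (faceColouring? A) {xs = allColourings M k} φ∈)))
        (∈-map⁺ paint (∈-cartesianProduct⁺ (∈-allVecs _ ∈-allFin (proj₁ (sample φ)))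
                                            (∈-allVecs _ ∈-allFin (proj₂ (sample φ)))))
      from : ∀ {φ} → φ ∈ map paint Ds → φ ∈ filter (faceColouring? A) (allColourings M k)
      from φ∈ with d , _ , refl ← ∈-map⁻ paint φ∈ =
        ∈-filter⁺ (faceColouring? A) (∈-allColourings _) (paint-faceColouring d)

  -- Double counting of the pairs of a subset `A` and a colouring constant along the faces that `A`
  -- produces.
  sum-permissible :
    ∑ (permissibleValuations M k) (λ φ → 2 ^ℕ tot M k φ) ≡
    ∑ (allSubsets n) (λ A → k ^ℕ f (partialPetrial G A))
  sum-permissible = begin
    ∑ (permissibleValuations M k) (λ φ → 2 ^ℕ tot M k φ)
      ≡⟨ ∑-filter (λ φ → valuation? M k φ ×-dec permissible? M k φ) _ (allColourings M k) ⟩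
    ∑ (allColourings M k) (λ φ → ⟦ valuation? M k φ ×-dec permissible? M k φ ⟧ *ℕ 2 ^ℕ tot M k φ)
      ≡⟨ ∑-cong (allColourings M k) pointwise ⟩
    ∑ (allColourings M k) (λ φ → ∑ (allSubsets n) (λ A → ⟦ faceColouring? A φ ⟧))
      ≡⟨ ∑-swap (allColourings M k) (allSubsets n) (λ φ A → ⟦ faceColouring? A φ ⟧) ⟩
    ∑ (allSubsets n) (λ A → ∑ (allColourings M k) (λ φ → ⟦ faceColouring? A φ ⟧))
      ≡⟨ ∑-cong (allSubsets n) count-faceColourings ⟩
    ∑ (allSubsets n) (λ A → k ^ℕ f (partialPetrial G A)) ∎
    where
    open ≡-Reasoning
    pointwise : ∀ φ → ⟦ valuation? M k φ ×-dec permissible? M k φ ⟧ *ℕ 2 ^ℕ tot M k φ ≡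
                      ∑ (allSubsets n) (λ A → ⟦ faceColouring? A φ ⟧)
    pointwise φ = begin
      ⟦ valuation? M k φ ×-dec permissible? M k φ ⟧ *ℕ 2 ^ℕ tot M k φ
        ≡⟨ cong (_*ℕ 2 ^ℕ tot M k φ) (⟦⟧-cong
             (valuation? M k φ ×-dec permissible? M k φ) (edgeColouring? φ ×-dec all?permitted)
             (λ ((edge , _) , perm) → edge , perm)
             (λ (edge , perm) → (edge , λ v → permitted-even (lookup (proj₁ φ) v) (perm v)) , perm)) ⟩
      ⟦ edgeColouring? φ ×-dec all?permitted ⟧ *ℕ 2 ^ℕ tot M k φ
        ≡⟨ cong (_*ℕ 2 ^ℕ tot M k φ) (⟦⟧-× (edgeColouring? φ) all?permitted) ⟩
      (⟦ edgeColouring? φ ⟧ *ℕ ⟦ all?permitted ⟧) *ℕ 2 ^ℕ tot M k φ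
        ≡⟨ ℕₚ.*-assoc ⟦ edgeColouring? φ ⟧ ⟦ all?permitted ⟧ (2 ^ℕ tot M k φ) ⟩
      ⟦ edgeColouring? φ ⟧ *ℕ (⟦ all?permitted ⟧ *ℕ 2 ^ℕ tot M k φ)
        ≡⟨ cong (⟦ edgeColouring? φ ⟧ *ℕ_) (count-fitting (proj₁ φ)) ⟨
      ⟦ edgeColouring? φ ⟧ *ℕ ∑ (allSubsets n) (λ A → ⟦ fitsAll? A (proj₁ φ) ⟧)
        ≡⟨ ∑-* (allSubsets n) ⟦ edgeColouring? φ ⟧ (λ A → ⟦ fitsAll? A (proj₁ φ) ⟧) ⟨
      ∑ (allSubsets n) (λ A → ⟦ edgeColouring? φ ⟧ *ℕ ⟦ fitsAll? A (proj₁ φ) ⟧)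
        ≡⟨ ∑-cong (allSubsets n) (λ A → sym (⟦⟧-× (edgeColouring? φ) (fitsAll? A (proj₁ φ)))) ⟩
      ∑ (allSubsets n) (λ A → ⟦ faceColouring? A φ ⟧) ∎
      where all?permitted = all? λ v → permitted? (lookup (proj₁ φ) v)

-- Extraction of the common sign

neg-power : ∀ k m → (- (+ k)) ^ m ≡ -1ℤ ^ m * + (k ^ℕ m)
neg-power k zero    = refl
neg-power k (suc m) = begin
  - (+ k) * (- (+ k)) ^ m             ≡⟨ cong₂ _*_ (sym (ℤₚ.-1*i≡-i (+ k))) (neg-power k m) ⟩
  (-1ℤ * + k) * (-1ℤ ^ m * + (k ^ℕ m)) ≡⟨ interchange -1ℤ (+ k) (-1ℤ ^ m) (+ (k ^ℕ m)) ⟩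
  -1ℤ ^ suc m * (+ k * + (k ^ℕ m))     ≡⟨ cong (-1ℤ ^ suc m *_) (ℤₚ.pos-* k (k ^ℕ m)) ⟨
  -1ℤ ^ suc m * + (k ^ℕ suc m)         ∎
  where
  open ≡-Reasoning
  interchange : ∀ a b c d → (a * b) * (c * d) ≡ (a * c) * (b * d)
  interchange = solveℤ-∀

-- With one sign `c` common to all terms nothing cancels, and the integer sum reduces to a sum of
-- natural numbers.
sumℤ-signed : ∀ {A : Set} (c : ℤ) (term : A → ℤ) (g : A → ℕ) →
  (∀ x → term x ≡ c * + g x) → ∀ xs → sumℤ (map term xs) ≡ c * + ∑ xs g
sumℤ-signed c term g eq []       = sym (ℤₚ.*-zeroʳ c)
sumℤ-signed c term g eq (x ∷ xs) = begin
  term x +ℤ sumℤ (map term xs)     ≡⟨ cong₂ _+ℤ_ (eq x) (sumℤ-signed c term g eq xs) ⟩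
  c * + g x +ℤ c * + ∑ xs g        ≡⟨ ℤₚ.*-distribˡ-+ c (+ g x) (+ ∑ xs g) ⟨
  c * (+ g x +ℤ + ∑ xs g)          ≡⟨ cong (c *_) (ℤₚ.pos-+ (g x) (∑ xs g)) ⟨
  c * + (g x + ∑ xs g)             ∎
  where open ≡-Reasoning

mainTheorem4 : (G : EmbeddedGraph) → Orientable (petrial (dual G)) → (k : ℕ) → .{{_ : NonZero k}} →
    P G (- (+ k)) ≡ (-1ℤ ^ f G) * (+ sum (map (λ φ → 2 ^ℕ tot (medial G) k φ) (permissibleValuations (medial G) k)))
mainTheorem4 G orientable k = trans
  (sumℤ-signed (-1ℤ ^ f G) _ (λ A → k ^ℕ f (partialPetrial G A)) term (allSubsets (edges G)))
  (cong (λ s → -1ℤ ^ f G * + s) (sym (sum-permissible G k)))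
  where
  open ≡-Reasoning
  term : ∀ A → -1ℤ ^ ∣ A ∣ * (- (+ k)) ^ f (partialPetrial G A) ≡
               -1ℤ ^ f G * + (k ^ℕ f (partialPetrial G A))
  term A = begin
    -1ℤ ^ ∣ A ∣ * (- (+ k)) ^ fA                  ≡⟨ cong (-1ℤ ^ ∣ A ∣ *_) (neg-power k fA) ⟩
    -1ℤ ^ ∣ A ∣ * (-1ℤ ^ fA * + (k ^ℕ fA))        ≡⟨ ℤₚ.*-assoc (-1ℤ ^ ∣ A ∣) (-1ℤ ^ fA) (+ (k ^ℕ fA)) ⟨
    (-1ℤ ^ ∣ A ∣ * -1ℤ ^ fA) * + (k ^ℕ fA)        ≡⟨ cong (_* + (k ^ℕ fA)) (ℤₚ.^-distribˡ-+-* -1ℤ ∣ A ∣ fA) ⟨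
    -1ℤ ^ (∣ A ∣ + fA) * + (k ^ℕ fA)              ≡⟨ cong (_* + (k ^ℕ fA)) (face-parity G orientable A) ⟩
    -1ℤ ^ f G * + (k ^ℕ fA)                       ∎
    where fA = f (partialPetrial G A)
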